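{- Let $G$ be a connected series-parallel graph and let $e \in E(G)$ be neither a bridge nor a loop. Then there exists $\varepsilon > 0$ such that $\mathrm{ex}(Q_n, Y(G,e)) = O(n^{ -\varepsilon} e(Q_n))$ as $n\to\infty$, where $e(Q_n) = n2^{n-1}$ is the number of edges of $Q_n$.
   Context: Graphs here may be multigraphs (loops and parallel edges allowed). A series-parallel graph is a multigraph with no $K_4$ minor. A spanning tree of a multigraph is a set of edges forming a tree containing every vertex. $Q_n$ is the $n$-dimensional hypercube with vertex set $\{0,1\}^n$. For $d \le n$, an embedding $Q_d \to Q_n$ is a graph isomorphism of $Q_d$ onto a $d$-dimensional face (subcube) of $Q_n$; it maps edges to edges. For $Y \subseteq E(Q_d)$, $\mathrm{ex}(Q_n, Y)$ is the maximum size of a set $S \subseteq E(Q_n)$ such that $\psi(Y) \not\subseteq S$ for every embedding $\psi: Q_d \to Q_n$. Given $G$ and $e$ as in the claim, fix an ordering of $E(G)\setminus\{e\}$, so that subsets of $E(G)\setminus\{e\}$ are identified with vertices of $Q_{e(G)-1}$. Then $Y(G,e) \subseteq E(Q_{e(G)-1})$ is the set of hypercube edges $\{S, S\cup\{e'\}\}$ (with $S \subseteq E(G)\setminus\{e\}$, $e' \in E(G)\setminus(S\cup\{e\})$) such that both $S\cup\{e\}$ and $S \cup \{e'\}$ are edge sets of spanning trees of $G$. -}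

module Defs where

open import Data.Nat using (ℕ; zero; suc; pred; _+_; _*_; _^_; _∸_; _≤_)
open import Data.Fin using (Fin; punchIn)
open import Data.Bool using (Bool; true; false; _∧_; not; if_then_else_)
open import Data.Maybe using (Maybe; just)
open import Data.Product using (Σ; ∃; _×_; _,_; proj₁; proj₂)
open import Data.Sum using (_⊎_)
open import Data.Vec using (Vec; []; _∷_; lookup; _[_]≔_)
open import Data.List using (List; []; _∷_; concatMap; map; allFin)
open import Data.Nat.ListAction using (sum)
open import Data.Unit using (⊤)
open import Relation.Binary.PropositionalEquality using (_≡_; _≢_)
open import Relation.Nullary using (¬_)
open import Function.Bundles using (_⇔_)

record MGraph : Set where
  field
    V    : ℕ
    E    : ℕ
    ends : Fin E → Fin V × Fin V

open MGraph public

Joins : (G : MGraph) → Fin (E G) → Fin (V G) → Fin (V G) → Set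
Joins G f x y = (ends G f ≡ (x , y)) ⊎ (ends G f ≡ (y , x))

data Reach (G : MGraph) (P : Fin (E G) → Set) : Fin (V G) → Fin (V G) → Set where
  here : ∀ {x} → Reach G P x x
  step : ∀ {x y z} (f : Fin (E G)) → P f → Joins G f x y → Reach G P y z → Reach G P x z

AllEdges : (G : MGraph) → Fin (E G) → Set
AllEdges G f = ⊤

Without : (G : MGraph) → (Fin (E G) → Set) → Fin (E G) → Fin (E G) → Set
Without G P f g = P g × g ≢ f

Connected : MGraph → Set
Connected G = ∀ x y → Reach G (AllEdges G) x y

IsLoop : (G : MGraph) → Fin (E G) → Set
IsLoop G f = proj₁ (ends G f) ≡ proj₂ (ends G f)

IsBridge : (G : MGraph) → Fin (E G) → Set
IsBridge G f = ¬ Reach G (Without G (AllEdges G) f) (proj₁ (ends G f)) (proj₂ (ends G f))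

-- T is the edge set of a spanning tree: (V, T) is connected and acyclic
-- (acyclic: no edge of T lies on a cycle of T, i.e. its endpoints are
--  disconnected in T minus that edge; this also excludes loops)
IsSpanningTree : (G : MGraph) → (Fin (E G) → Set) → Set
IsSpanningTree G T =
  (∀ x y → Reach G T x y) ×
  (∀ f → T f → ¬ Reach G (Without G T f) (proj₁ (ends G f)) (proj₂ (ends G f)))

-- K4 minor via a minor model: four nonempty, connected, disjoint branch
-- sets (β x = just i means x lies in branch set i), pairwise joined by an edge
InBranch : (G : MGraph) → (Fin (V G) → Maybe (Fin 4)) → Fin 4 → Fin (E G) → Set
InBranch G β i f = (β (proj₁ (ends G f)) ≡ just i) × (β (proj₂ (ends G f)) ≡ just i)

HasK4Minor : MGraph → Set
HasK4Minor G = Σ (Fin (V G) → Maybe (Fin 4)) λ β →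
  (∀ i → ∃ λ x → β x ≡ just i) ×
  (∀ i x y → β x ≡ just i → β y ≡ just i → Reach G (InBranch G β i) x y) ×
  (∀ i j → i ≢ j → ∃ λ f →
     ((β (proj₁ (ends G f)) ≡ just i) × (β (proj₂ (ends G f)) ≡ just j)) ⊎
     ((β (proj₁ (ends G f)) ≡ just j) × (β (proj₂ (ends G f)) ≡ just i)))

SeriesParallel : MGraph → Set
SeriesParallel G = ¬ HasK4Minor G

-- Hypercube Q_n: vertices Vec Bool n.  An edge is represented canonically
-- by (x , i) with lookup x i ≡ false: it is {x , x [ i ]≔ true}.

Adj : (n : ℕ) → Vec Bool n → Vec Bool n → Set
Adj n x y = ∃ λ i → (lookup x i ≢ lookup y i) × (∀ j → j ≢ i → lookup x j ≡ lookup y j)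

-- a set of edges of Q_n (value on non-canonical pairs is irrelevant)
QEdgeSet : ℕ → Set
QEdgeSet n = Vec Bool n → Fin n → Bool

allVecs : (n : ℕ) → List (Vec Bool n)
allVecs zero = [] ∷ []
allVecs (suc n) = concatMap (λ v → (false ∷ v) ∷ (true ∷ v) ∷ []) (allVecs n)

size : {n : ℕ} → QEdgeSet n → ℕ
size {n} S = sum (map (λ x → sum (map (λ i →
  if not (lookup x i) ∧ S x i then 1 else 0) (allFin n))) (allVecs n))

MemE : {n : ℕ} → QEdgeSet n → Vec Bool n → Vec Bool n → Set
MemE S u v = ∃ λ i →
  ((lookup u i ≡ false) × (v ≡ u [ i ]≔ true) × (S u i ≡ true)) ⊎
  ((lookup v i ≡ false) × (u ≡ v [ i ]≔ true) × (S v i ≡ true))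

count : {n : ℕ} → Vec Bool n → ℕ
count [] = 0
count (true ∷ v) = suc (count v)
count (false ∷ v) = count v

-- the image of ψ is a d-dimensional face: free coordinates D (|D| = d),
-- all other coordinates fixed to those of b
IsFaceImage : (d n : ℕ) → (Vec Bool d → Vec Bool n) → Set
IsFaceImage d n ψ = Σ (Vec Bool n) λ D → Σ (Vec Bool n) λ b →
  (count D ≡ d) ×
  (∀ y → (∃ λ x → ψ x ≡ y) ⇔ (∀ j → lookup D j ≡ false → lookup y j ≡ lookup b j))

Embedding : ℕ → ℕ → Set
Embedding d n = Σ (Vec Bool d → Vec Bool n) λ ψ →
  IsFaceImage d n ψ ×
  (∀ x y → ψ x ≡ ψ y → x ≡ y) ×
  (∀ x y → Adj d x y ⇔ Adj n (ψ x) (ψ y))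

-- Y(G,e) ⊆ E(Q_{e(G)-1}).  E(G) \ {e} is ordered via punchIn e, so that
-- coordinate j of Q_{e(G)-1} corresponds to the edge skip e j of G.

skip : {m : ℕ} → Fin m → Fin (pred m) → Fin m
skip {suc m} e j = punchIn e j

Lift : (G : MGraph) (e : Fin (E G)) → Vec Bool (pred (E G)) → Fin (E G) → Fin (E G) → Set
Lift G e S g f = (f ≡ g) ⊎ (∃ λ j → (skip e j ≡ f) × (lookup S j ≡ true))

-- the canonical edge (S , i) = {S , S ∪ {e'}}, e' = skip e i, lies in Y(G,e)
InY : (G : MGraph) (e : Fin (E G)) → Vec Bool (pred (E G)) → Fin (pred (E G)) → Set
InY G e S i = IsSpanningTree G (Lift G e S e) × IsSpanningTree G (Lift G e S (skip e i))

CopyIn : (G : MGraph) (e : Fin (E G)) {n : ℕ} → Embedding (pred (E G)) n → QEdgeSet n → Set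
CopyIn G e (ψ , _) S = ∀ x i → lookup x i ≡ false → InY G e x i →
  MemE S (ψ x) (ψ (x [ i ]≔ true))

-- S contains no copy ψ(Y(G,e)); ex(Q_n, Y) is the max of size over such S
YFree : (G : MGraph) (e : Fin (E G)) (n : ℕ) → QEdgeSet n → Set
YFree G e n S = ∀ (ψ : Embedding (pred (E G)) n) → ¬ CopyIn G e ψ S

eQ : ℕ → ℕ
eQ n = n * 2 ^ (n ∸ 1)

{-# OPTIONS --safe #-}
module Submission where

-- Let D be a set of directed edges of Q_n of density δ.  A homomorphic copy of the cube on E(G) \ e is given
-- by z ∈ Q_n and an arbitrary map φ : E(G) → [n]; it sends a vertex l to z + Σ_{f ∈ l} φ f.  A random such
-- copy carries Y(G,e) into D with probability at least δ^C, where C depends on G only.  As φ is injective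
-- with probability 1 − O(1/n), this gives ε = 1/C.
--
-- The probability bound is preserved by series-parallel operations on the edges other than e.  If f and f′
-- are parallel, no forest contains both, so Y(G,e) is hit as soon as Y(G − f,e) is hit by φ and also by φ
-- with φ f′ replaced by φ f; these are conditionally independent events, and Cauchy-Schwarz applies.
-- Series edges are dual; loops and pendant edges are harmless.
--
-- It remains to see that a connected graph without K4 minor and with an edge ab has a vertex v ≠ a, b with at
-- most two neighbours, unless a and b are all of its vertices.  In a minimal counterexample, contracting a
-- neighbour v of a into a makes some vertex small, so v and a have a common neighbour of degree three.
-- Repeating this at that neighbour gives adjacent vertices p, q of degree three in a triangle with a.  If their third
-- neighbours differ, contracting pq keeps the other degrees large; if they coincide, contracting p and q
-- into the common neighbour x does, possibly after contracting x further.

open import Defs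
open import Data.Nat using (ℕ; _*_; _^_; _≤_)
open import Data.Fin using (Fin)
open import Data.Product using (Σ; _×_)
open import Relation.Nullary using (¬_)

open import Data.Nat using (zero; suc; _+_; _<_; z≤n; s≤s; NonZero)
open import Data.Nat.Induction using (<-rec)
open import Data.Nat.ListAction using (sum)
open import Data.Nat.Properties
open import Data.Nat.Solver using (module +-*-Solver)
open import Data.Bool using (Bool; true; false; not; if_then_else_; _∧_; _xor_) renaming (_≟_ to _≟ᵇ_)
open import Data.Bool.Properties using (not-involutive)
open import Data.Empty using (⊥; ⊥-elim)
open import Data.Fin using (zero; suc; punchIn; punchOut) renaming (_≟_ to _≟ᶠ_)
open import Data.Fin.Properties using (any?; all?; ¬∀⟶∃¬; punchIn-punchOut; punchOut-punchIn; punchInᵢ≢i; punchOut-cong; punchIn-injective) renaming (suc-injective to Fin-suc-injective)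
open import Data.List using (List; []; _∷_; _++_; map; concatMap; allFin; length)
open import Data.List.Membership.Propositional using (_∈_; _∉_)
open import Data.List.Properties using (length-tabulate; map-tabulate)
open import Data.List.Relation.Unary.Any using (here; there)
open import Data.Maybe using (Maybe; just; nothing)
open import Data.Product using (∃; _,_; proj₁; proj₂)
open import Data.Product.Properties using () renaming (≡-dec to ×-≡-dec)
open import Data.Sum using (_⊎_; inj₁; inj₂; swap; [_,_]′)
open import Data.Unit using (⊤; tt)
open import Data.Vec using (Vec; []; _∷_; lookup; updateAt; _[_]≔_; insertAt; replicate; tabulate)
open import Data.Vec.Properties
open import Function using (_∘_; id)
open import Function.Bundles using (_⇔_; mk⇔)
open import Relation.Nullary using (contradiction; yes; no; Dec; does; ¬?; _×-dec_; _⊎-dec_; _→-dec_)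
open import Relation.Nullary.Decidable using (dec-true; dec-false)
open import Relation.Binary.PropositionalEquality

-- Sums over cubes and over maps between finite sets

-- The parallel step works because the event for G - f does not depend on `φ f`, which can therefore
-- serve as an independent second sample for f′. In the series step a tree may miss one of the two
-- edges, and contracting the edge that it uses takes that edge out of `l`; so the base point `z`
-- has to move along, by a different amount in each case. Such translations may reverse an edge of
-- the cube, which is why `D` consists of directed edges. Every Cauchy-Schwarz squares the
-- probability, so C starts at 1 and doubles at each parallel or series step. No reduction may touch
-- e, and its ends must stay distinct. Hence the structural lemma is about a marked edge ab and asks
-- for a vertex away from both ends. The reduction stops at a single edge parallel to e, where the
-- expected number of hits is the density itself, or at an empty pattern.

∑ : {A : Set} → List A → (A → ℕ) → ℕ
∑ xs f = sum (map f xs)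

∑-cong : {A : Set} (xs : List A) {f g : A → ℕ} → (∀ x → f x ≡ g x) → ∑ xs f ≡ ∑ xs g
∑-cong []       eq = refl
∑-cong (x ∷ xs) eq = cong₂ _+_ (eq x) (∑-cong xs eq)

∑-mono : {A : Set} (xs : List A) {f g : A → ℕ} → (∀ x → f x ≤ g x) → ∑ xs f ≤ ∑ xs g
∑-mono []       le = z≤n
∑-mono (x ∷ xs) le = +-mono-≤ (le x) (∑-mono xs le)

∑-+ : {A : Set} (xs : List A) (f g : A → ℕ) → ∑ xs (λ x → f x + g x) ≡ ∑ xs f + ∑ xs g
∑-+ []       f g = refl
∑-+ (x ∷ xs) f g rewrite ∑-+ xs f g =
  solve 4 (λ a b c d → (a :+ b) :+ (c :+ d) := (a :+ c) :+ (b :+ d)) refl (f x) (g x) (∑ xs f) (∑ xs g)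
  where open +-*-Solver

∑-*ˡ : {A : Set} (xs : List A) (c : ℕ) (f : A → ℕ) → ∑ xs (λ x → c * f x) ≡ c * ∑ xs f
∑-*ˡ []       c f = sym (*-zeroʳ c)
∑-*ˡ (x ∷ xs) c f rewrite ∑-*ˡ xs c f = sym (*-distribˡ-+ c (f x) (∑ xs f))

∑-*ʳ : {A : Set} (xs : List A) (c : ℕ) (f : A → ℕ) → ∑ xs (λ x → f x * c) ≡ ∑ xs f * c
∑-*ʳ xs c f = trans (∑-cong xs (λ x → *-comm (f x) c)) (trans (∑-*ˡ xs c f) (*-comm c (∑ xs f)))

∑-const : {A : Set} (xs : List A) (c : ℕ) → ∑ xs (λ _ → c) ≡ length xs * c
∑-const []       c = refl
∑-const (x ∷ xs) c = cong (c +_) (∑-const xs c)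

∑-zero : {A : Set} (xs : List A) → ∑ xs (λ _ → 0) ≡ 0
∑-zero xs = trans (∑-const xs 0) (*-zeroʳ (length xs))

∑-swap : {A B : Set} (xs : List A) (ys : List B) (f : A → B → ℕ) →
  ∑ xs (λ x → ∑ ys (f x)) ≡ ∑ ys (λ y → ∑ xs (λ x → f x y))
∑-swap []       ys f = sym (∑-zero ys)
∑-swap (x ∷ xs) ys f = trans (cong (∑ ys (f x) +_) (∑-swap xs ys f))
  (sym (∑-+ ys (f x) (λ y → ∑ xs (λ x′ → f x′ y))))

∑-++ : {A : Set} (xs ys : List A) (f : A → ℕ) → ∑ (xs ++ ys) f ≡ ∑ xs f + ∑ ys f
∑-++ []       ys f = refl
∑-++ (x ∷ xs) ys f = trans (cong (f x +_) (∑-++ xs ys f)) (sym (+-assoc (f x) (∑ xs f) (∑ ys f)))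

∑-concatMap : {A B : Set} (h : A → List B) (xs : List A) (f : B → ℕ) →
  ∑ (concatMap h xs) f ≡ ∑ xs (λ x → ∑ (h x) f)
∑-concatMap h []       f = refl
∑-concatMap h (x ∷ xs) f = trans (∑-++ (h x) (concatMap h xs) f) (cong (∑ (h x) f +_) (∑-concatMap h xs f))

∑-map : {A B : Set} (h : A → B) (xs : List A) (f : B → ℕ) → ∑ (map h xs) f ≡ ∑ xs (λ x → f (h x))
∑-map h []       f = refl
∑-map h (x ∷ xs) f = cong (f (h x) +_) (∑-map h xs f)

2ab≤a²+b² : ∀ a b → 2 * (a * b) ≤ a * a + b * b
2ab≤a²+b² a b with ≤-total a b
... | inj₁ a≤b with m≤n⇒∃[o]m+o≡n a≤b
...   | k , refl = ≤-trans (m≤m+n _ (k * k)) (≤-reflexive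
        (solve 2 (λ x y → con 2 :* (x :* (x :+ y)) :+ y :* y := x :* x :+ (x :+ y) :* (x :+ y)) refl a k))
  where open +-*-Solver
2ab≤a²+b² a b | inj₂ b≤a with m≤n⇒∃[o]m+o≡n b≤a
...   | k , refl = ≤-trans (m≤m+n _ (k * k)) (≤-reflexive
        (solve 2 (λ x y → con 2 :* ((x :+ y) :* x) :+ y :* y := (x :+ y) :* (x :+ y) :+ x :* x) refl b k))
  where open +-*-Solver

-- Induction on the list. The cross terms with the new entry are absorbed one by one by `2ab≤a²+b²`,
-- which produces `N` copies of the new square and one of each old square.
cauchySchwarz : {A : Set} (xs : List A) (f : A → ℕ) →
  ∑ xs f * ∑ xs f ≤ length xs * ∑ xs (λ x → f x * f x)
cauchySchwarz []       f = z≤n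
cauchySchwarz (x ∷ xs) f = begin
  (a + s) * (a + s)                     ≡⟨ solve 2 (λ a s → (a :+ s) :* (a :+ s) := a :* a :+ con 2 :* (a :* s) :+ s :* s) refl a s ⟩
  a * a + 2 * (a * s) + s * s           ≤⟨ +-mono-≤ (+-monoʳ-≤ (a * a) cross) (cauchySchwarz xs f) ⟩
  a * a + (N * (a * a) + Q) + N * Q     ≡⟨ solve 3 (λ b N Q → b :+ (N :* b :+ Q) :+ N :* Q := (con 1 :+ N) :* (b :+ Q)) refl (a * a) N Q ⟩
  suc N * (a * a + Q)                   ∎
  where
  open ≤-Reasoning
  open +-*-Solver
  a = f x
  s = ∑ xs f
  N = length xs
  Q = ∑ xs (λ y → f y * f y)
  cross : 2 * (a * s) ≤ N * (a * a) + Q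
  cross = begin
    2 * (a * s)                              ≡⟨ cong (2 *_) (sym (∑-*ˡ xs a f)) ⟩
    2 * ∑ xs (λ y → a * f y)                 ≡⟨ sym (∑-*ˡ xs 2 (λ y → a * f y)) ⟩
    ∑ xs (λ y → 2 * (a * f y))               ≤⟨ ∑-mono xs (λ y → 2ab≤a²+b² a (f y)) ⟩
    ∑ xs (λ y → a * a + f y * f y)           ≡⟨ ∑-+ xs (λ _ → a * a) (λ y → f y * f y) ⟩
    ∑ xs (λ _ → a * a) + Q                   ≡⟨ cong (_+ Q) (∑-const xs (a * a)) ⟩
    N * (a * a) + Q                          ∎

∑-allVecs-suc : ∀ {n} (f : Vec Bool (suc n) → ℕ) →
  ∑ (allVecs (suc n)) f ≡ ∑ (allVecs n) (λ v → f (false ∷ v) + f (true ∷ v))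
∑-allVecs-suc {n} f = trans (∑-concatMap _ (allVecs n) f)
  (∑-cong (allVecs n) (λ v → cong (f (false ∷ v) +_) (+-identityʳ (f (true ∷ v)))))

∑-allVecs-const : ∀ n c → ∑ (allVecs n) (λ _ → c) ≡ 2 ^ n * c
∑-allVecs-const zero    c = refl
∑-allVecs-const (suc n) c = begin
  ∑ (allVecs (suc n)) (λ _ → c)  ≡⟨ ∑-allVecs-suc {n} (λ _ → c) ⟩
  ∑ (allVecs n) (λ _ → c + c)    ≡⟨ ∑-allVecs-const n (c + c) ⟩
  2 ^ n * (c + c)                ≡⟨ solve 2 (λ a c → a :* (c :+ c) := con 2 :* a :* c) refl (2 ^ n) c ⟩
  2 ^ suc n * c                  ∎
  where open ≡-Reasoning
        open +-*-Solver

flip : ∀ {n} → Fin n → Vec Bool n → Vec Bool n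
flip i z = updateAt z i not

∑-allVecs-flip : ∀ {n} (i : Fin n) (f : Vec Bool n → ℕ) →
  ∑ (allVecs n) (λ z → f (flip i z)) ≡ ∑ (allVecs n) f
∑-allVecs-flip {suc n} zero f = begin
  ∑ (allVecs (suc n)) (λ z → f (flip zero z))              ≡⟨ ∑-allVecs-suc (λ z → f (flip zero z)) ⟩
  ∑ (allVecs n) (λ v → f (true ∷ v) + f (false ∷ v))       ≡⟨ ∑-cong (allVecs n) (λ v → +-comm (f (true ∷ v)) _) ⟩
  ∑ (allVecs n) (λ v → f (false ∷ v) + f (true ∷ v))       ≡⟨ sym (∑-allVecs-suc f) ⟩
  ∑ (allVecs (suc n)) f                                    ∎
  where open ≡-Reasoning
∑-allVecs-flip {suc n} (suc i) f = begin
  ∑ (allVecs (suc n)) (λ z → f (flip (suc i) z))                        ≡⟨ ∑-allVecs-suc (λ z → f (flip (suc i) z)) ⟩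
  ∑ (allVecs n) (λ v → f (false ∷ flip i v) + f (true ∷ flip i v))      ≡⟨ ∑-allVecs-flip i (λ v → f (false ∷ v) + f (true ∷ v)) ⟩
  ∑ (allVecs n) (λ v → f (false ∷ v) + f (true ∷ v))                    ≡⟨ sym (∑-allVecs-suc f) ⟩
  ∑ (allVecs (suc n)) f                                                 ∎
  where open ≡-Reasoning

-- Clearing bit `i` is two-to-one onto the points where the bit is off. In this way the two
-- orientations of an edge will be traced back to its canonical one.
∑-allVecs-clear : ∀ {n} (i : Fin n) (f : Vec Bool n → ℕ) →
  ∑ (allVecs n) (λ z → f (z [ i ]≔ false)) ≡ 2 * ∑ (allVecs n) (λ z → if not (lookup z i) then f z else 0)
∑-allVecs-clear {suc n} zero f = begin
  ∑ (allVecs (suc n)) (λ z → f (z [ zero ]≔ false))          ≡⟨ ∑-allVecs-suc (λ z → f (z [ zero ]≔ false)) ⟩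
  ∑ (allVecs n) (λ v → f (false ∷ v) + f (false ∷ v))        ≡⟨ ∑-cong (allVecs n) (λ v → solve 1 (λ a → a :+ a := con 2 :* (a :+ con 0)) refl (f (false ∷ v))) ⟩
  ∑ (allVecs n) (λ v → 2 * (f (false ∷ v) + 0))              ≡⟨ ∑-*ˡ (allVecs n) 2 _ ⟩
  2 * ∑ (allVecs n) (λ v → f (false ∷ v) + 0)                ≡⟨ cong (2 *_) (sym (∑-allVecs-suc {n} (λ z → if not (lookup z zero) then f z else 0))) ⟩
  2 * ∑ (allVecs (suc n)) (λ z → if not (lookup z zero) then f z else 0) ∎
  where open ≡-Reasoning
        open +-*-Solver
∑-allVecs-clear {suc n} (suc i) f = begin
  ∑ (allVecs (suc n)) (λ z → f (z [ suc i ]≔ false))                    ≡⟨ ∑-allVecs-suc (λ z → f (z [ suc i ]≔ false)) ⟩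
  ∑ (allVecs n) (λ v → g (v [ i ]≔ false))                              ≡⟨ ∑-allVecs-clear i g ⟩
  2 * ∑ (allVecs n) (λ v → if not (lookup v i) then g v else 0)         ≡⟨ cong (2 *_) (∑-cong (allVecs n) (λ v → if-+ (not (lookup v i)))) ⟩
  2 * ∑ (allVecs n) (λ v → (if not (lookup v i) then f (false ∷ v) else 0) + (if not (lookup v i) then f (true ∷ v) else 0))
                                                                        ≡⟨ cong (2 *_) (sym (∑-allVecs-suc {n} (λ z → if not (lookup z (suc i)) then f z else 0))) ⟩
  2 * ∑ (allVecs (suc n)) (λ z → if not (lookup z (suc i)) then f z else 0) ∎
  where
  open ≡-Reasoning
  g : Vec Bool n → ℕ
  g v = f (false ∷ v) + f (true ∷ v)
  if-+ : ∀ b {x y} → (if b then x + y else 0) ≡ (if b then x else 0) + (if b then y else 0)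
  if-+ true  = refl
  if-+ false = refl

allMaps : ∀ d n → List (Vec (Fin n) d)
allMaps zero    n = [] ∷ []
allMaps (suc d) n = concatMap (λ φ → map (_∷ φ) (allFin n)) (allMaps d n)

∑-allMaps-suc : ∀ {d n} (f : Vec (Fin n) (suc d) → ℕ) →
  ∑ (allMaps (suc d) n) f ≡ ∑ (allMaps d n) (λ φ → ∑ (allFin n) (λ i → f (i ∷ φ)))
∑-allMaps-suc {d} {n} f = trans (∑-concatMap _ (allMaps d n) f)
  (∑-cong (allMaps d n) (λ φ → ∑-map (_∷ φ) (allFin n) f))

∑-allFin-const : ∀ n c → ∑ (allFin n) (λ _ → c) ≡ n * c
∑-allFin-const n c = trans (∑-const (allFin n) c) (cong (_* c) (length-tabulate {n = n} (λ i → i)))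

∑-allMaps-const : ∀ d n c → ∑ (allMaps d n) (λ _ → c) ≡ n ^ d * c
∑-allMaps-const zero    n c = refl
∑-allMaps-const (suc d) n c = begin
  ∑ (allMaps (suc d) n) (λ _ → c)                   ≡⟨ ∑-allMaps-suc {d} (λ _ → c) ⟩
  ∑ (allMaps d n) (λ _ → ∑ (allFin n) (λ _ → c))    ≡⟨ ∑-cong (allMaps d n) (λ _ → ∑-allFin-const n c) ⟩
  ∑ (allMaps d n) (λ _ → n * c)                     ≡⟨ ∑-allMaps-const d n (n * c) ⟩
  n ^ d * (n * c)                                   ≡⟨ solve 3 (λ a n c → a :* (n :* c) := n :* a :* c) refl (n ^ d) n c ⟩
  n ^ suc d * c                                     ∎
  where open ≡-Reasoning
        open +-*-Solver

-- Overwriting one entry of a uniform `φ` by an independent uniform value does not change its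
-- distribution. The later uses of independence rest on this identity.
∑-resample : ∀ {d n} (k : Fin d) (f : Vec (Fin n) d → ℕ) →
  ∑ (allMaps d n) (λ φ → ∑ (allFin n) (λ i → f (φ [ k ]≔ i))) ≡ n * ∑ (allMaps d n) f
∑-resample {suc d} {n} zero f = begin
  ∑ (allMaps (suc d) n) (λ φ → ∑ (allFin n) (λ i → f (φ [ zero ]≔ i)))             ≡⟨ ∑-allMaps-suc {d} (λ φ → ∑ (allFin n) (λ i → f (φ [ zero ]≔ i))) ⟩
  ∑ (allMaps d n) (λ φ → ∑ (allFin n) (λ _ → ∑ (allFin n) (λ i → f (i ∷ φ))))      ≡⟨ ∑-cong (allMaps d n) (λ φ → ∑-allFin-const n _) ⟩
  ∑ (allMaps d n) (λ φ → n * ∑ (allFin n) (λ i → f (i ∷ φ)))                       ≡⟨ ∑-*ˡ (allMaps d n) n _ ⟩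
  n * ∑ (allMaps d n) (λ φ → ∑ (allFin n) (λ i → f (i ∷ φ)))                       ≡⟨ cong (n *_) (sym (∑-allMaps-suc {d} f)) ⟩
  n * ∑ (allMaps (suc d) n) f                                                      ∎
  where open ≡-Reasoning
∑-resample {suc d} {n} (suc k) f = begin
  ∑ (allMaps (suc d) n) (λ φ → ∑ (allFin n) (λ i → f (φ [ suc k ]≔ i)))                  ≡⟨ ∑-allMaps-suc {d} (λ φ → ∑ (allFin n) (λ i → f (φ [ suc k ]≔ i))) ⟩
  ∑ (allMaps d n) (λ φ → ∑ (allFin n) (λ j → ∑ (allFin n) (λ i → f (j ∷ φ [ k ]≔ i))))   ≡⟨ ∑-cong (allMaps d n) (λ φ → ∑-swap (allFin n) (allFin n) (λ j i → f (j ∷ φ [ k ]≔ i))) ⟩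
  ∑ (allMaps d n) (λ φ → ∑ (allFin n) (λ i → g (φ [ k ]≔ i)))                            ≡⟨ ∑-resample k g ⟩
  n * ∑ (allMaps d n) g                                                                  ≡⟨ cong (n *_) (sym (∑-allMaps-suc {d} f)) ⟩
  n * ∑ (allMaps (suc d) n) f                                                            ∎
  where
  open ≡-Reasoning
  g : Vec (Fin n) d → ℕ
  g φ = ∑ (allFin n) (λ j → f (j ∷ φ))

-- Homomorphic copies of a cube and their weights

-- Flips along equal entries of `φ` cancel, as in a vector space over the field of two elements, so
-- maps that are not injective need no special treatment.
act : ∀ {n d} → Vec Bool n → Vec (Fin n) d → Vec Bool d → Vec Bool n
act z []      []      = z
act z (i ∷ φ) (b ∷ l) = act (if b then flip i z else z) φ l

flip-involutive : ∀ {n} (i : Fin n) z → flip i (flip i z) ≡ z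
flip-involutive i z = trans (updateAt-updateAt i z) (updateAt-id-local i z (not-involutive _))

flip-comm : ∀ {n} (i j : Fin n) z → flip i (flip j z) ≡ flip j (flip i z)
flip-comm i j z with i ≟ᶠ j
... | yes refl = refl
... | no i≢j   = updateAt-commutes i j i≢j z

act-flip : ∀ {n d} i z (φ : Vec (Fin n) d) l → act (flip i z) φ l ≡ flip i (act z φ l)
act-flip i z []      []          = refl
act-flip i z (j ∷ φ) (true ∷ l)  = trans (cong (λ w → act w φ l) (flip-comm j i z)) (act-flip i (flip j z) φ l)
act-flip i z (j ∷ φ) (false ∷ l) = act-flip i z φ l

-- A translation of the base point makes up for an edge taken out of `l`. Contracting a tree edge
-- relies on this.
act-remove : ∀ {n d} z (φ : Vec (Fin n) d) l x → lookup l x ≡ true →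
  act (flip (lookup φ x) z) φ (l [ x ]≔ false) ≡ act z φ l
act-remove z (i ∷ φ) (true ∷ l)  zero    eq = refl
act-remove z (i ∷ φ) (true ∷ l)  (suc x) eq =
  trans (cong (λ w → act w φ (l [ x ]≔ false)) (flip-comm i (lookup φ x) z)) (act-remove (flip i z) φ l x eq)
act-remove z (i ∷ φ) (false ∷ l) (suc x) eq = act-remove z φ l x eq

act-ignore : ∀ {n d} z (φ : Vec (Fin n) d) l y i → lookup l y ≡ false → act z (φ [ y ]≔ i) l ≡ act z φ l
act-ignore z (j ∷ φ) (false ∷ l) zero    i eq = refl
act-ignore z (j ∷ φ) (b ∷ l)     (suc y) i eq = act-ignore (if b then flip j z else z) φ l y i eq

act-empty : ∀ {n d} z (φ : Vec (Fin n) d) l → (∀ h → lookup l h ≡ false) → act z φ l ≡ z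
act-empty z []      []          none = refl
act-empty z (i ∷ φ) (true ∷ l)  none = contradiction (none zero) (λ ())
act-empty z (i ∷ φ) (false ∷ l) none = act-empty z φ l (none ∘ suc)

set-clear : ∀ {d} (l : Vec Bool d) i → lookup l i ≡ false → (l [ i ]≔ true) [ i ]≔ false ≡ l
set-clear l i eq = trans ([]≔-idempotent l i) (trans (cong (l [ i ]≔_) (sym eq)) ([]≔-lookup l i))

act-insert : ∀ {n d} z (φ : Vec (Fin n) d) l i → lookup l i ≡ false →
  act z φ (l [ i ]≔ true) ≡ flip (lookup φ i) (act z φ l)
act-insert z φ l i eq = trans (sym (act-remove z φ (l [ i ]≔ true) i (lookup∘update i l true)))
  (trans (cong (act _ φ) (set-clear l i eq)) (act-flip (lookup φ i) z φ l))

Injective : ∀ {n d} → Vec (Fin n) d → Set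
Injective φ = ∀ i j → lookup φ i ≡ lookup φ j → i ≡ j

lookup-act-off : ∀ {n d} z (φ : Vec (Fin n) d) l k → (∀ j → lookup l j ≡ true → lookup φ j ≢ k) →
  lookup (act z φ l) k ≡ lookup z k
lookup-act-off z []      []          k off = refl
lookup-act-off z (i ∷ φ) (true ∷ l)  k off = trans (lookup-act-off (flip i z) φ l k (off ∘ suc))
  (lookup∘updateAt′ k i (λ k≡i → off zero refl (sym k≡i)) z)
lookup-act-off z (i ∷ φ) (false ∷ l) k off = lookup-act-off z φ l k (off ∘ suc)

lookup-act-on : ∀ {n d} z (φ : Vec (Fin n) d) → Injective φ → ∀ l j →
  lookup (act z φ l) (lookup φ j) ≡ (lookup l j xor lookup z (lookup φ j))
lookup-act-on z φ inj l j with lookup l j in eq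
... | false = lookup-act-off z φ l (lookup φ j) λ j′ on φj′≡φj →
  contradiction (trans (sym on) (trans (cong (lookup l) (inj j′ j φj′≡φj)) eq)) (λ ())
... | true  = trans (cong (λ w → lookup w (lookup φ j)) (trans (sym (act-remove z φ l j eq)) (act-flip (lookup φ j) z φ l′)))
  (trans (lookup∘updateAt (lookup φ j) (act z φ l′)) (cong not off))
  where
  l′ = l [ j ]≔ false
  off : lookup (act z φ l′) (lookup φ j) ≡ lookup z (lookup φ j)
  off = lookup-act-off z φ l′ (lookup φ j) λ j′ on φj′≡φj →
    contradiction (trans (sym on) (trans (cong (lookup l′) (inj j′ j φj′≡φj)) (lookup∘update j l false))) (λ ())

Weight : ℕ → ℕ → Set
Weight n d = Vec Bool n → Vec (Fin n) d → ℕ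

total : ∀ {n d} → Weight n d → ℕ
total {n} {d} P = ∑ (allVecs n) (λ z → ∑ (allMaps d n) (P z))

mass : ℕ → ℕ → ℕ
mass n d = 2 ^ n * n ^ d

total-cong : ∀ {n d} {P Q : Weight n d} → (∀ z φ → P z φ ≡ Q z φ) → total P ≡ total Q
total-cong {n} {d} eq = ∑-cong (allVecs n) (λ z → ∑-cong (allMaps d n) (eq z))

total-mono : ∀ {n d} {P Q : Weight n d} → (∀ z φ → P z φ ≤ Q z φ) → total P ≤ total Q
total-mono {n} {d} le = ∑-mono (allVecs n) (λ z → ∑-mono (allMaps d n) (le z))

total-one : ∀ n d → total {n} {d} (λ _ _ → 1) ≡ mass n d
total-one n d = trans (∑-cong (allVecs n) (λ z → ∑-allMaps-const d n 1))
  (trans (∑-allVecs-const n (n ^ d * 1)) (cong (2 ^ n *_) (*-identityʳ (n ^ d))))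

-- For fixed `φ` the translation by `lookup φ k` permutes the cube, so a total does not see it.
total-flip : ∀ {n d} (P : Weight n d) k → total (λ z φ → P (flip (lookup φ k) z) φ) ≡ total P
total-flip {n} {d} P k = begin
  total (λ z φ → P (flip (lookup φ k) z) φ)                                          ≡⟨ ∑-swap (allVecs n) (allMaps d n) _ ⟩
  ∑ (allMaps d n) (λ φ → ∑ (allVecs n) (λ z → P (flip (lookup φ k) z) φ))            ≡⟨ ∑-cong (allMaps d n) (λ φ → ∑-allVecs-flip (lookup φ k) (λ z → P z φ)) ⟩
  ∑ (allMaps d n) (λ φ → ∑ (allVecs n) (λ z → P z φ))                                ≡⟨ sym (∑-swap (allVecs n) (allMaps d n) P) ⟩
  total P                                                                            ∎
  where open ≡-Reasoning

length-by-sum : ∀ {A : Set} (xs : List A) → length xs ≡ ∑ xs (λ _ → 1)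
length-by-sum xs = sym (trans (∑-const xs 1) (*-identityʳ _))

total-cauchySchwarz : ∀ {n d} (P : Weight n d) → total P * total P ≤ mass n d * total (λ z φ → P z φ * P z φ)
total-cauchySchwarz {n} {d} P = begin
  total P * total P                                                  ≤⟨ cauchySchwarz (allVecs n) _ ⟩
  N * ∑ (allVecs n) (λ z → ∑ Φ (P z) * ∑ Φ (P z))                    ≤⟨ *-monoʳ-≤ N (∑-mono (allVecs n) (λ z → cauchySchwarz Φ (P z))) ⟩
  N * ∑ (allVecs n) (λ z → M * ∑ Φ (λ φ → P z φ * P z φ))            ≡⟨ cong (N *_) (∑-*ˡ (allVecs n) M _) ⟩
  N * (M * total (λ z φ → P z φ * P z φ))                            ≡⟨ sym (*-assoc N M _) ⟩
  N * M * total (λ z φ → P z φ * P z φ)                              ≡⟨ cong (_* total (λ z φ → P z φ * P z φ)) (cong₂ _*_ N≡ M≡) ⟩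
  mass n d * total (λ z φ → P z φ * P z φ)                           ∎
  where
  open ≤-Reasoning
  Φ = allMaps d n
  N = length (allVecs n)
  M = length Φ
  N≡ : N ≡ 2 ^ n
  N≡ = trans (length-by-sum (allVecs n)) (trans (∑-allVecs-const n 1) (*-identityʳ _))
  M≡ : M ≡ n ^ d
  M≡ = trans (length-by-sum Φ) (trans (∑-allMaps-const d n 1) (*-identityʳ _))

total-resample : ∀ {n d} (P : Weight n d) k →
  total (λ z φ → ∑ (allFin n) (λ i → P z (φ [ k ]≔ i))) ≡ n * total P
total-resample {n} {d} P k = trans (∑-cong (allVecs n) (λ z → ∑-resample k (P z))) (∑-*ˡ (allVecs n) n _)

-- Conditionally on the other coordinates, the two factors are independent copies of P.
total-duplicate : ∀ {n d} .{{_ : NonZero n}} (P : Weight n d) f f′ → f ≢ f′ →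
  (∀ z φ i → P z (φ [ f ]≔ i) ≡ P z φ) →
  total P * total P ≤ mass n d * total (λ z φ → P z φ * P z (φ [ f′ ]≔ lookup φ f))
total-duplicate {n} {d} P f f′ f≢f′ ignores = *-cancelˡ-≤ (n * n) {{m*n≢0 n n}} (begin
  n * n * (total P * total P)                                ≡⟨ solve 2 (λ n t → n :* n :* (t :* t) := (n :* t) :* (n :* t)) refl n (total P) ⟩
  (n * total P) * (n * total P)                              ≡⟨ cong (λ t → t * t) (sym (total-resample P f′)) ⟩
  total A * total A                                          ≤⟨ total-cauchySchwarz A ⟩
  mass n d * total (λ z φ → A z φ * A z φ)                   ≡⟨ cong (mass n d *_) (total-cong A²) ⟩
  mass n d * total (λ z φ → ∑ (allFin n) (λ j → ∑ (allFin n) (λ i → P′ z ((φ [ f ]≔ j) [ f′ ]≔ i))))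
                                                             ≡⟨ cong (mass n d *_) (total-resample (λ z φ → ∑ (allFin n) (λ i → P′ z (φ [ f′ ]≔ i))) f) ⟩
  mass n d * (n * total (λ z φ → ∑ (allFin n) (λ i → P′ z (φ [ f′ ]≔ i))))
                                                             ≡⟨ cong (λ t → mass n d * (n * t)) (total-resample P′ f′) ⟩
  mass n d * (n * (n * total P′))                            ≡⟨ solve 3 (λ m n t → m :* (n :* (n :* t)) := n :* n :* (m :* t)) refl (mass n d) n (total P′) ⟩
  n * n * (mass n d * total P′)                              ∎)
  where
  open ≤-Reasoning
  open +-*-Solver
  A P′ : Weight n d
  A z φ  = ∑ (allFin n) (λ i → P z (φ [ f′ ]≔ i))
  P′ z φ = P z φ * P z (φ [ f′ ]≔ lookup φ f)
  first : ∀ z φ j i → P z ((φ [ f ]≔ j) [ f′ ]≔ i) ≡ P z (φ [ f′ ]≔ i)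
  first z φ j i = trans (cong (P z) ([]≔-commutes φ f f′ f≢f′)) (ignores z (φ [ f′ ]≔ i) j)
  second : ∀ z φ j i → P z (((φ [ f ]≔ j) [ f′ ]≔ i) [ f′ ]≔ lookup ((φ [ f ]≔ j) [ f′ ]≔ i) f) ≡ P z (φ [ f′ ]≔ j)
  second z φ j i = trans (cong (P z) (trans ([]≔-idempotent (φ [ f ]≔ j) f′)
    (cong ((φ [ f ]≔ j) [ f′ ]≔_) (trans (lookup∘update′ f≢f′ (φ [ f ]≔ j) i) (lookup∘update f φ j)))))
    (first z φ j j)
  -- Expanding the square gives two independent values for entry `f′`. As `P` ignores entry `f`, one
  -- of them can be stored there.
  A² : ∀ z φ → A z φ * A z φ ≡ ∑ (allFin n) (λ j → ∑ (allFin n) (λ i → P′ z ((φ [ f ]≔ j) [ f′ ]≔ i)))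
  A² z φ = begin-equality
    A z φ * A z φ                                                                  ≡⟨ sym (∑-*ˡ (allFin n) (A z φ) (λ j → P z (φ [ f′ ]≔ j))) ⟩
    ∑ (allFin n) (λ j → A z φ * P z (φ [ f′ ]≔ j))                                 ≡⟨ ∑-cong (allFin n) (λ j → sym (∑-*ʳ (allFin n) _ _)) ⟩
    ∑ (allFin n) (λ j → ∑ (allFin n) (λ i → P z (φ [ f′ ]≔ i) * P z (φ [ f′ ]≔ j)))
      ≡⟨ ∑-cong (allFin n) (λ j → ∑-cong (allFin n) (λ i → sym (cong₂ _*_ (first z φ j i) (second z φ j i)))) ⟩
    ∑ (allFin n) (λ j → ∑ (allFin n) (λ i → P′ z ((φ [ f ]≔ j) [ f′ ]≔ i)))        ∎

-- Resampling entry `k` turns the summand into a constant in `φ`; in other words, `z` and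
-- `lookup φ k` form a uniform directed edge.
total-mean : ∀ {n d} (g : Vec Bool n → Fin n → ℕ) (k : Fin d) →
  n * total {n} {d} (λ z φ → g z (lookup φ k)) ≡ n ^ d * ∑ (allVecs n) (λ z → ∑ (allFin n) (g z))
total-mean {n} {d} g k = begin
  n * total {n} {d} (λ z φ → g z (lookup φ k))                                          ≡⟨ sym (total-resample {n} {d} (λ z φ → g z (lookup φ k)) k) ⟩
  total {n} {d} (λ z φ → ∑ (allFin n) (λ i → g z (lookup (φ [ k ]≔ i) k)))              ≡⟨ total-cong {n} {d} (λ z φ → ∑-cong (allFin n) (λ i → cong (g z) (lookup∘update k φ i))) ⟩
  total {n} {d} (λ z φ → ∑ (allFin n) (g z))                                            ≡⟨ ∑-cong (allVecs n) (λ z → ∑-allMaps-const d n _) ⟩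
  ∑ (allVecs n) (λ z → n ^ d * ∑ (allFin n) (g z))                                      ≡⟨ ∑-*ˡ (allVecs n) (n ^ d) _ ⟩
  n ^ d * ∑ (allVecs n) (λ z → ∑ (allFin n) (g z))                                      ∎
  where open ≡-Reasoning

-- Coincidences among the entries of a random map

∑-allFin-suc : ∀ n (f : Fin (suc n) → ℕ) → ∑ (allFin (suc n)) f ≡ f zero + ∑ (allFin n) (f ∘ suc)
∑-allFin-suc n f = cong (f zero +_) (cong sum (trans (map-tabulate suc f) (sym (map-tabulate (λ i → i) (f ∘ suc)))))

term≤∑ : ∀ {n} (f : Fin n → ℕ) i → f i ≤ ∑ (allFin n) f
term≤∑ {suc n} f zero    = ≤-trans (m≤m+n _ _) (≤-reflexive (sym (∑-allFin-suc n f)))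
term≤∑ {suc n} f (suc i) = ≤-trans (≤-trans (term≤∑ (f ∘ suc) i) (m≤n+m _ (f zero))) (≤-reflexive (sym (∑-allFin-suc n f)))

δ : ∀ {n} → Fin n → Fin n → ℕ
δ i j = if does (i ≟ᶠ j) then 1 else 0

δ-refl : ∀ {n} (i : Fin n) → δ i i ≡ 1
δ-refl i = cong (if_then 1 else 0) (dec-true (i ≟ᶠ i) refl)

δ-distinct : ∀ {n} {i j : Fin n} → i ≢ j → δ i j ≡ 0
δ-distinct {i = i} {j} i≢j = cong (if_then 1 else 0) (dec-false (i ≟ᶠ j) i≢j)

∑-δ : ∀ {n} (c : Fin n) → ∑ (allFin n) (λ i → δ i c) ≡ 1
∑-δ {suc n} zero    = trans (∑-allFin-suc n (λ i → δ i zero)) (cong suc (trans (∑-cong (allFin n) (λ i → δ-distinct {i = suc i} {zero} (λ ()))) (∑-zero (allFin n))))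
∑-δ {suc n} (suc c) = trans (∑-allFin-suc n (λ i → δ i (suc c))) (trans (∑-cong (allFin n) δ-suc) (∑-δ c))
  where
  δ-suc : ∀ i → δ (suc i) (suc c) ≡ δ i c
  δ-suc i with i ≟ᶠ c
  ... | yes refl = refl
  ... | no  _    = refl

clash : ∀ {n d} → Fin d → Fin d → Vec (Fin n) d → ℕ
clash i j φ = if does (i ≟ᶠ j) then 0 else δ (lookup φ i) (lookup φ j)

clashes : ∀ {n d} → Vec (Fin n) d → ℕ
clashes {n} {d} φ = ∑ (allFin d) (λ i → ∑ (allFin d) (λ j → clash i j φ))

-- When entry `i` is resampled, exactly one of its `n` values meets entry `j`.
∑-clash : ∀ {n d} (i j : Fin d) → n * ∑ (allMaps d n) (clash i j) ≤ n ^ d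
∑-clash {n} {d} i j with i ≟ᶠ j
... | yes _  = ≤-trans (≤-reflexive (trans (cong (n *_) (∑-zero (allMaps d n))) (*-zeroʳ n))) z≤n
... | no i≢j = ≤-reflexive (begin
  n * ∑ (allMaps d n) (λ φ → δ (lookup φ i) (lookup φ j))       ≡⟨ sym (∑-resample i _) ⟩
  ∑ (allMaps d n) (λ φ → ∑ (allFin n) (λ k → δ (lookup (φ [ i ]≔ k) i) (lookup (φ [ i ]≔ k) j)))
    ≡⟨ ∑-cong (allMaps d n) (λ φ → trans (∑-cong (allFin n) (λ k → cong₂ δ (lookup∘update i φ k) (lookup∘update′ (i≢j ∘ sym) φ k))) (∑-δ (lookup φ j))) ⟩
  ∑ (allMaps d n) (λ φ → 1)                                     ≡⟨ trans (∑-allMaps-const d n 1) (*-identityʳ _) ⟩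
  n ^ d                                                         ∎)
  where open ≡-Reasoning

∑-clashes : ∀ n d → n * ∑ (allMaps d n) clashes ≤ d * d * n ^ d
∑-clashes n d = begin
  n * ∑ Φ clashes                                                           ≡⟨ cong (n *_) (∑-swap Φ F (λ φ i → ∑ F (λ j → clash i j φ))) ⟩
  n * ∑ F (λ i → ∑ Φ (λ φ → ∑ F (λ j → clash i j φ)))                       ≡⟨ cong (n *_) (∑-cong F (λ i → ∑-swap Φ F (λ φ j → clash i j φ))) ⟩
  n * ∑ F (λ i → ∑ F (λ j → ∑ Φ (clash i j)))                               ≡⟨ sym (trans (∑-cong F (λ i → ∑-*ˡ F n _)) (∑-*ˡ F n _)) ⟩
  ∑ F (λ i → ∑ F (λ j → n * ∑ Φ (clash i j)))                               ≤⟨ ∑-mono F (λ i → ∑-mono F (λ j → ∑-clash i j)) ⟩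
  ∑ F (λ i → ∑ F (λ j → n ^ d))                                             ≡⟨ trans (∑-cong F (λ i → ∑-allFin-const d _)) (trans (∑-allFin-const d _) (sym (*-assoc d d _))) ⟩
  d * d * n ^ d                                                             ∎
  where
  open ≤-Reasoning
  Φ = allMaps d n
  F = allFin d

injective-or-clash : ∀ {n d} (φ : Vec (Fin n) d) → ¬ Injective φ → 1 ≤ clashes φ
injective-or-clash {n} {d} φ ¬inj with any? (λ i → any? (λ j → ¬? (i ≟ᶠ j) ×-dec (lookup φ i ≟ᶠ lookup φ j)))
... | yes (i , j , i≢j , φi≡φj) = begin
  1                                     ≡⟨ sym clash≡1 ⟩
  clash i j φ                           ≤⟨ term≤∑ (λ j → clash i j φ) j ⟩
  ∑ (allFin d) (λ j → clash i j φ)      ≤⟨ term≤∑ (λ i → ∑ (allFin d) (λ j → clash i j φ)) i ⟩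
  clashes φ                             ∎
  where
  open ≤-Reasoning
  clash≡1 : clash i j φ ≡ 1
  clash≡1 = trans (cong (if_then 0 else δ (lookup φ i) (lookup φ j)) (dec-false (i ≟ᶠ j) i≢j))
    (trans (cong (λ k → δ k (lookup φ j)) φi≡φj) (δ-refl (lookup φ j)))
... | no none = contradiction inj ¬inj
  where
  inj : Injective φ
  inj i j eq with i ≟ᶠ j
  ... | yes i≡j = i≡j
  ... | no i≢j  = contradiction (i , j , i≢j , eq) none

-- A union bound over the ordered pairs of entries, each of which coincides with probability 1/n.
-- The factor `d * d` will become the constant of the theorem.
total-clashes : ∀ {n d} (P : Weight n d) → (∀ z φ → P z φ ≤ 1) → (∀ z φ → P z φ ≢ 0 → ¬ Injective φ) →
  n * total P ≤ d * d * mass n d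
total-clashes {n} {d} P P≤1 support = begin
  n * total P                                            ≤⟨ *-monoʳ-≤ n (total-mono P≤clashes) ⟩
  n * total {n} {d} (λ _ → clashes)                      ≡⟨ cong (n *_) (∑-allVecs-const n _) ⟩
  n * (2 ^ n * ∑ (allMaps d n) clashes)                  ≡⟨ solve 3 (λ n a b → n :* (a :* b) := a :* (n :* b)) refl n (2 ^ n) (∑ (allMaps d n) clashes) ⟩
  2 ^ n * (n * ∑ (allMaps d n) clashes)                  ≤⟨ *-monoʳ-≤ (2 ^ n) (∑-clashes n d) ⟩
  2 ^ n * (d * d * n ^ d)                                ≡⟨ solve 3 (λ a b c → a :* (b :* c) := b :* (a :* c)) refl (2 ^ n) (d * d) (n ^ d) ⟩
  d * d * mass n d                                       ∎
  where
  open ≤-Reasoning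
  open +-*-Solver
  P≤clashes : ∀ z φ → P z φ ≤ clashes φ
  P≤clashes z φ with P z φ in eq
  ... | zero  = z≤n
  ... | suc p = ≤-trans (subst (_≤ 1) eq (P≤1 z φ)) (injective-or-clash φ (support z φ (λ p≡0 → 0≢1+n (trans (sym p≡0) eq))))

-- Contractions and minors

Ends : ℕ → ℕ → Set
Ends n m = Fin m → Fin n × Fin n

graph : ∀ {n m} → Ends n m → MGraph
graph {n} {m} g = record { V = n ; E = m ; ends = g }

src tgt : ∀ {n m} → Ends n m → Fin m → Fin n
src g f = proj₁ (g f)
tgt g f = proj₂ (g f)

module _ {n m : ℕ} {g : Ends n m} where

  joins-ends : ∀ f → Joins (graph g) f (src g f) (tgt g f)
  joins-ends f = inj₁ refl

  joins-cases : ∀ {f x y} → Joins (graph g) f x y → (src g f ≡ x × tgt g f ≡ y) ⊎ (src g f ≡ y × tgt g f ≡ x)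
  joins-cases (inj₁ eq) = inj₁ (cong proj₁ eq , cong proj₂ eq)
  joins-cases (inj₂ eq) = inj₂ (cong proj₁ eq , cong proj₂ eq)

  reach-trans : ∀ {P x y z} → Reach (graph g) P x y → Reach (graph g) P y z → Reach (graph g) P x z
  reach-trans here          r = r
  reach-trans (step f p j s) r = step f p j (reach-trans s r)

  reach-sym : ∀ {P x y} → Reach (graph g) P x y → Reach (graph g) P y x
  reach-sym here           = here
  reach-sym (step f p j s) = reach-trans (reach-sym s) (step f p (swap j) here)

  reach-bind : ∀ {P Q : Fin m → Set} → (∀ f → P f → Reach (graph g) Q (src g f) (tgt g f)) →
    ∀ {x y} → Reach (graph g) P x y → Reach (graph g) Q x y
  reach-bind h here = here
  reach-bind {P} {Q} h (step f p j s) = reach-trans (edge (joins-cases {f} j)) (reach-bind h s)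
    where
    edge : ∀ {x y} → (src g f ≡ x × tgt g f ≡ y) ⊎ (src g f ≡ y × tgt g f ≡ x) → Reach (graph g) Q x y
    edge (inj₁ (refl , refl)) = h f p
    edge (inj₂ (refl , refl)) = reach-sym (h f p)

  reach-edge : ∀ {P : Fin m → Set} {x y} f → P f → Joins (graph g) f x y → Reach (graph g) P x y
  reach-edge f p j = step f p j here

  reach-mono : ∀ {P Q : Fin m → Set} → (∀ f → P f → Q f) → ∀ {x y} → Reach (graph g) P x y → Reach (graph g) Q x y
  reach-mono h = reach-bind (λ f p → reach-edge f (h f p) (joins-ends f))

-- Contraction relabels ends and keeps the index set of the edges; contracted edges become loops. So
-- the coordinates of `φ` and `l` stay the same throughout the induction.
image : ∀ {n k m} → (Fin n → Fin k) → Ends n m → Ends k m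
image μ g f = μ (src g f) , μ (tgt g f)

module _ {n k m : ℕ} (μ : Fin n → Fin k) (g : Ends n m) where

  joins-image : ∀ {f x y} → Joins (graph g) f x y → Joins (graph (image μ g)) f (μ x) (μ y)
  joins-image (inj₁ eq) = inj₁ (cong (λ e → μ (proj₁ e) , μ (proj₂ e)) eq)
  joins-image (inj₂ eq) = inj₂ (cong (λ e → μ (proj₁ e) , μ (proj₂ e)) eq)

  reach-image : ∀ {P Q : Fin m → Set} → (∀ f → P f → Q f ⊎ μ (src g f) ≡ μ (tgt g f)) →
    ∀ {x y} → Reach (graph g) P x y → Reach (graph (image μ g)) Q (μ x) (μ y)
  reach-image h here = here
  reach-image {P} {Q} h {x} {z} (step {y = y} f p j s) with h f p
  ... | inj₁ q  = step f q (joins-image {f} j) (reach-image h s)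
  ... | inj₂ eq = subst (λ w → Reach (graph (image μ g)) Q w (μ z)) (μy≡μx (joins-cases {g = g} {f} j)) (reach-image h s)
    where
    μy≡μx : (src g f ≡ x × tgt g f ≡ y) ⊎ (src g f ≡ y × tgt g f ≡ x) → μ y ≡ μ x
    μy≡μx (inj₁ (refl , refl)) = sym eq
    μy≡μx (inj₂ (refl , refl)) = eq

  -- Every step lifts to the edge with the same index, and `fibre` closes the gap between the end of
  -- one lifted edge and the start of the next. The predicate `In` confines the walk to a branch
  -- set, as only there are fibres known to be connected.
  reach-lift : ∀ {P Q : Fin m → Set} (In : Fin k → Set) →
    (∀ x y → μ x ≡ μ y → In (μ x) → Reach (graph g) P x y) →
    (∀ f → Q f → P f × In (μ (src g f)) × In (μ (tgt g f))) →
    ∀ {p q} → Reach (graph (image μ g)) Q p q → ∀ x y → μ x ≡ p → μ y ≡ q → In p → Reach (graph g) P x y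
  reach-lift In fibre h here x y μx≡p μy≡p In-p = fibre x y (trans μx≡p (sym μy≡p)) (subst In (sym μx≡p) In-p)
  reach-lift {P} In fibre h (step {y = q} f qf j s) x y refl μy≡r In-p with joins-cases {g = image μ g} {f} j
  ... | inj₁ (a≡ , b≡) = reach-trans (fibre x (src g f) (sym a≡) In-p)
          (step f (proj₁ (h f qf)) (inj₁ refl)
            (reach-lift In fibre h s (tgt g f) y b≡ μy≡r (subst In b≡ (proj₂ (proj₂ (h f qf))))))
  ... | inj₂ (b≡ , a≡) = reach-trans (fibre x (tgt g f) (sym a≡) In-p)
          (step f (proj₁ (h f qf)) (inj₂ refl)
            (reach-lift In fibre h s (src g f) y b≡ μy≡r (subst In b≡ (proj₁ (proj₂ (h f qf))))))

module Merge {n : ℕ} (v u : Fin (suc n)) (v≢u : v ≢ u) where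

  merge : Fin (suc n) → Fin n
  merge x with v ≟ᶠ x
  ... | yes _   = punchOut v≢u
  ... | no v≢x  = punchOut v≢x

  merge-same : merge v ≡ merge u
  merge-same with v ≟ᶠ v | v ≟ᶠ u
  ... | yes _  | yes v≡u = contradiction v≡u v≢u
  ... | yes _  | no _    = punchOut-cong v refl
  ... | no v≢v | _       = contradiction refl v≢v

  merge-punchIn : ∀ y → merge (punchIn v y) ≡ y
  merge-punchIn y with v ≟ᶠ punchIn v y
  ... | yes v≡ = contradiction (sym v≡) (punchInᵢ≢i v y)
  ... | no v≢  = trans (punchOut-cong v refl) (punchOut-punchIn v)

  punchIn-merge : ∀ {x} → x ≢ v → punchIn v (merge x) ≡ x
  punchIn-merge {x} x≢v with v ≟ᶠ x
  ... | yes v≡x = contradiction (sym v≡x) x≢v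
  ... | no v≢x  = punchIn-punchOut v≢x

  merge-cancel : ∀ {x y} → x ≢ v → y ≢ v → merge x ≡ merge y → x ≡ y
  merge-cancel x≢v y≢v eq = trans (sym (punchIn-merge x≢v)) (trans (cong (punchIn v) eq) (punchIn-merge y≢v))

  merge-fibre : ∀ {x y} → merge x ≡ merge y → (x ≡ y) ⊎ (x ≡ v × y ≡ u) ⊎ (x ≡ u × y ≡ v)
  merge-fibre {x} {y} eq with x ≟ᶠ v | y ≟ᶠ v
  ... | yes refl | yes refl = inj₁ refl
  ... | yes refl | no y≢v   = inj₂ (inj₁ (refl , merge-cancel y≢v (v≢u ∘ sym) (trans (sym eq) merge-same)))
  ... | no x≢v   | yes refl = inj₂ (inj₂ (merge-cancel x≢v (v≢u ∘ sym) (trans eq merge-same) , refl))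
  ... | no x≢v   | no y≢v   = inj₁ (merge-cancel x≢v y≢v eq)

  fibre-reach : ∀ {m} {g : Ends (suc n) m} {P : Fin m → Set} f → P f → Joins (graph g) f v u →
    ∀ x y → merge x ≡ merge y → Reach (graph g) P x y
  fibre-reach f p j x y eq with merge-fibre eq
  ... | inj₁ refl                 = here
  ... | inj₂ (inj₁ (refl , refl)) = reach-edge f p j
  ... | inj₂ (inj₂ (refl , refl)) = reach-edge f p (swap j)

  -- Branch sets are pulled back along `merge`. The one that receives both `v` and `u` stays
  -- connected because the edge `f` lies inside it.
  k4-lift : ∀ {m} {g : Ends (suc n) m} f → Joins (graph g) f v u →
    HasK4Minor (graph (image merge g)) → HasK4Minor (graph g)
  k4-lift {m} {g} f j (β , nonempty , connected , adjacent) = β ∘ merge , nonempty′ , connected′ , adjacent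
    where
    nonempty′ : ∀ i → ∃ λ x → β (merge x) ≡ just i
    nonempty′ i with nonempty i
    ... | x , βx≡i = punchIn v x , trans (cong β (merge-punchIn x)) βx≡i

    connected′ : ∀ i x y → β (merge x) ≡ just i → β (merge y) ≡ just i → Reach (graph g) (InBranch (graph g) (β ∘ merge) i) x y
    connected′ i x y βx βy = reach-lift merge g (λ p → β p ≡ just i) fibre (λ f q → q , q) (connected i (merge x) (merge y) βx βy) x y refl refl βx
      where
      fibre : ∀ x y → merge x ≡ merge y → β (merge x) ≡ just i → Reach (graph g) (InBranch (graph g) (β ∘ merge) i) x y
      fibre x y eq βx with merge-fibre eq
      ... | inj₁ refl                 = here
      ... | inj₂ (inj₁ (refl , refl)) = reach-edge f (branch (joins-cases {g = g} {f} j)) j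
        where
        branch : (src g f ≡ v × tgt g f ≡ u) ⊎ (src g f ≡ u × tgt g f ≡ v) → InBranch (graph g) (β ∘ merge) i f
        branch (inj₁ (refl , refl)) = βx , trans (cong β (sym eq)) βx
        branch (inj₂ (refl , refl)) = trans (cong β (sym eq)) βx , βx
      ... | inj₂ (inj₂ (refl , refl)) = reach-edge f (branch (joins-cases {g = g} {f} j)) (swap j)
        where
        branch : (src g f ≡ v × tgt g f ≡ u) ⊎ (src g f ≡ u × tgt g f ≡ v) → InBranch (graph g) (β ∘ merge) i f
        branch (inj₁ (refl , refl)) = trans (cong β (sym eq)) βx , βx
        branch (inj₂ (refl , refl)) = βx , trans (cong β (sym eq)) βx

connected-image : ∀ {n k m} (μ : Fin n → Fin k) (g : Ends n m) → (∀ y → ∃ λ x → μ x ≡ y) →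
  Connected (graph g) → Connected (graph (image μ g))
connected-image μ g onto conn x y with onto x | onto y
... | a , refl | b , refl = reach-image μ g (λ f _ → inj₁ tt) (conn a b)

Adjacent : ∀ {n m} → Ends n m → Fin n → Fin n → Set
Adjacent g x y = ∃ λ f → Joins (graph g) f x y

adjacent-sym : ∀ {n m} {g : Ends n m} {x y} → Adjacent g x y → Adjacent g y x
adjacent-sym (f , j) = f , swap j

joins? : ∀ {n m} (g : Ends n m) f x y → Dec (Joins (graph g) f x y)
joins? g f x y = ×-≡-dec _≟ᶠ_ _≟ᶠ_ (g f) (x , y) ⊎-dec ×-≡-dec _≟ᶠ_ _≟ᶠ_ (g f) (y , x)

adjacent? : ∀ {n m} (g : Ends n m) x y → Dec (Adjacent g x y)
adjacent? g x y = any? (λ f → joins? g f x y)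

-- Loops and multiplicities are disregarded, and `p` and `q` may coincide or fail to be neighbours.
-- Multiplicities are dealt with separately, by making the edges of `X` simple before a small vertex
-- is used.
Small : ∀ {n m} → Ends n m → Fin n → Set
Small g w = ∃ λ p → ∃ λ q → ∀ x → Adjacent g w x → x ≡ w ⊎ x ≡ p ⊎ x ≡ q

small? : ∀ {n m} (g : Ends n m) w → Dec (Small g w)
small? g w = any? λ p → any? λ q → all? λ x → adjacent? g w x →-dec ((x ≟ᶠ w) ⊎-dec ((x ≟ᶠ p) ⊎-dec (x ≟ᶠ q)))

further-neighbour : ∀ {n m} {g : Ends n m} {w} → ¬ Small g w → ∀ p q →
  ∃ λ x → Adjacent g w x × x ≢ w × x ≢ p × x ≢ q
further-neighbour {n} {m} {g} {w} ¬small p q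
  with ¬∀⟶∃¬ n _ (λ x → adjacent? g w x →-dec ((x ≟ᶠ w) ⊎-dec ((x ≟ᶠ p) ⊎-dec (x ≟ᶠ q)))) (λ all → ¬small (p , q , all))
... | x , ¬all with adjacent? g w x
...   | yes adj = x , adj , (λ eq → ¬all (λ _ → inj₁ eq)) , (λ eq → ¬all (λ _ → inj₂ (inj₁ eq))) , (λ eq → ¬all (λ _ → inj₂ (inj₂ eq)))
...   | no ¬adj = ⊥-elim (¬all (λ adj → ⊥-elim (¬adj adj)))

k4-clique : ∀ {n m} {g : Ends n m} (c : Fin 4 → Fin n) → (∀ i j → c i ≡ c j → i ≡ j) →
  (∀ i j → i ≢ j → Adjacent g (c i) (c j)) → HasK4Minor (graph g)
k4-clique {n} {m} {g} c inj adj = β , (λ i → c i , β-c i) , connected , adjacent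
  where
  β : Fin n → Maybe (Fin 4)
  β x with any? (λ i → c i ≟ᶠ x)
  ... | yes (i , _) = just i
  ... | no _        = nothing

  β-c : ∀ i → β (c i) ≡ just i
  β-c i with any? (λ j → c j ≟ᶠ c i)
  ... | yes (j , eq) = cong just (inj j i eq)
  ... | no none      = contradiction (i , refl) none

  β-inv : ∀ {x i} → β x ≡ just i → c i ≡ x
  β-inv {x} eq with any? (λ i → c i ≟ᶠ x)
  β-inv refl | yes (i , ci≡x) = ci≡x

  connected : ∀ i x y → β x ≡ just i → β y ≡ just i → Reach (graph g) (InBranch (graph g) β i) x y
  connected i x y βx βy with trans (sym (β-inv {x} βx)) (β-inv {y} βy)
  ... | refl = here

  adjacent : ∀ i j → i ≢ j → ∃ λ f →
    ((β (src g f) ≡ just i) × (β (tgt g f) ≡ just j)) ⊎ ((β (src g f) ≡ just j) × (β (tgt g f) ≡ just i))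
  adjacent i j i≢j with adj i j i≢j
  ... | f , joins with joins-cases {g = g} {f} joins
  ...   | inj₁ (s , t) = f , inj₁ (trans (cong β s) (β-c i) , trans (cong β t) (β-c j))
  ...   | inj₂ (s , t) = f , inj₂ (trans (cong β s) (β-c j) , trans (cong β t) (β-c i))

k4-four : ∀ {n m} {g : Ends n m} {a b c d} → a ≢ b → a ≢ c → a ≢ d → b ≢ c → b ≢ d → c ≢ d →
  Adjacent g a b → Adjacent g a c → Adjacent g a d → Adjacent g b c → Adjacent g b d → Adjacent g c d →
  HasK4Minor (graph g)
k4-four {n} {m} {g} {a} {b} {c} {d} a≢b a≢c a≢d b≢c b≢d c≢d ab ac ad bc bd cd = k4-clique corner distinct edge
  where
  corner : Fin 4 → Fin n
  corner zero                   = a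
  corner (suc zero)             = b
  corner (suc (suc zero))       = c
  corner (suc (suc (suc zero))) = d

  pair : ∀ i j → i ≡ j ⊎ (corner i ≢ corner j × Adjacent g (corner i) (corner j))
  pair zero zero = inj₁ refl
  pair zero (suc zero) = inj₂ (a≢b , ab)
  pair zero (suc (suc zero)) = inj₂ (a≢c , ac)
  pair zero (suc (suc (suc zero))) = inj₂ (a≢d , ad)
  pair (suc zero) zero = inj₂ (a≢b ∘ sym , adjacent-sym ab)
  pair (suc zero) (suc zero) = inj₁ refl
  pair (suc zero) (suc (suc zero)) = inj₂ (b≢c , bc)
  pair (suc zero) (suc (suc (suc zero))) = inj₂ (b≢d , bd)
  pair (suc (suc zero)) zero = inj₂ (a≢c ∘ sym , adjacent-sym ac)
  pair (suc (suc zero)) (suc zero) = inj₂ (b≢c ∘ sym , adjacent-sym bc)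
  pair (suc (suc zero)) (suc (suc zero)) = inj₁ refl
  pair (suc (suc zero)) (suc (suc (suc zero))) = inj₂ (c≢d , cd)
  pair (suc (suc (suc zero))) zero = inj₂ (a≢d ∘ sym , adjacent-sym ad)
  pair (suc (suc (suc zero))) (suc zero) = inj₂ (b≢d ∘ sym , adjacent-sym bd)
  pair (suc (suc (suc zero))) (suc (suc zero)) = inj₂ (c≢d ∘ sym , adjacent-sym cd)
  pair (suc (suc (suc zero))) (suc (suc (suc zero))) = inj₁ refl

  distinct : ∀ i j → corner i ≡ corner j → i ≡ j
  distinct i j eq with pair i j
  ... | inj₁ i≡j       = i≡j
  ... | inj₂ (neq , _) = contradiction eq neq

  edge : ∀ i j → i ≢ j → Adjacent g (corner i) (corner j)
  edge i j i≢j with pair i j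
  ... | inj₁ i≡j       = contradiction i≡j i≢j
  ... | inj₂ (_ , adj) = adj

-- A vertex with at most two neighbours

-- The quotient of `g` by contracting the vertices of `R` into `u`. The section `σ` picks `u` from
-- the contracted class, so that statements about the quotient can be read in `g` through `rep`.
-- That K4 minors lift is carried along as a field, since it is proved one contraction at a time.
record Collapse {n m} (g : Ends n m) (R : List (Fin n)) (u : Fin n) : Set where
  field
    k     : ℕ
    order  : k + length R ≡ n
    μ     : Fin n → Fin k
    σ     : Fin k → Fin n
    μσ    : ∀ y → μ (σ y) ≡ y
    σ∉    : ∀ y → σ y ∉ R
    keep  : ∀ {y} → y ∉ R → σ (μ y) ≡ y
    root  : ∀ {y} → y ∈ R → μ y ≡ μ u
    u∉    : u ∉ R
    k4    : HasK4Minor (graph (image μ g)) → HasK4Minor (graph g)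

  rep : Fin n → Fin n
  rep y = σ (μ y)

  rep-root : ∀ {y} → y ∈ R → rep y ≡ u
  rep-root y∈R = trans (cong σ (root y∈R)) (keep u∉)

  μ-distinct : ∀ {x y} → x ∉ R → y ∉ R → x ≢ y → μ x ≢ μ y
  μ-distinct x∉R y∉R x≢y eq = x≢y (trans (sym (keep x∉R)) (trans (cong σ eq) (keep y∉R)))

  μ-adjacent : ∀ {x y} → Adjacent g x y → Adjacent (image μ g) (μ x) (μ y)
  μ-adjacent (f , j) = f , joins-image μ g {f} j

collapse-none : ∀ {n m} (g : Ends n m) u → Collapse g [] u
collapse-none {n} g u = record
  { k = n ; order = +-identityʳ n ; μ = id ; σ = id ; μσ = λ _ → refl ; σ∉ = λ _ ()
  ; keep = λ _ → refl ; root = λ () ; u∉ = λ () ; k4 = id }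

-- The neighbour `w` of `v` may be any vertex of the class of `u`; the edge between them then ends
-- at `u` in the quotient.
collapse-step : ∀ {n m} {g : Ends n m} {R u} → Collapse g R u → ∀ v w → v ∉ R → v ≢ u → w ∈ u ∷ R →
  Adjacent g v w → Collapse g (v ∷ R) u
collapse-step {g = g} {R} {u} record { k = zero ; μ = μ } v w v∉R v≢u w∈ adj with μ v
... | ()
collapse-step {g = g} {R} {u} C@record { k = suc k ; order = order ; μ = μ ; σ = σ ; μσ = μσ ; σ∉ = σ∉ ; keep = keep ; root = root ; u∉ = u∉ ; k4 = k4 }
  v w v∉R v≢u w∈ adj = record
  { k    = k
  ; order = trans (+-suc k (length R)) order
  ; μ    = merge ∘ μ
  ; σ    = σ ∘ punchIn (μ v)
  ; μσ   = λ y → trans (cong merge (μσ (punchIn (μ v) y))) (merge-punchIn y)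
  ; σ∉   = σ∉′
  ; keep = λ {y} y∉ → trans (cong σ (punchIn-merge (λ eq → y∉ (here (trans (sym (keep (y∉ ∘ there))) (trans (cong σ eq) (keep v∉R))))))) (keep (y∉ ∘ there))
  ; root = λ { (here refl) → merge-same ; (there y∈R) → cong merge (root y∈R) }
  ; u∉   = λ { (here u≡v) → v≢u (sym u≡v) ; (there u∈R) → u∉ u∈R }
  ; k4   = k4 ∘ k4-lift {g = image μ g} (proj₁ adj) (joins-uv w∈ (joins-image μ g {proj₁ adj} (proj₂ adj)))
  }
  where
  open Merge (μ v) (μ u) (Collapse.μ-distinct C v∉R u∉ v≢u)

  σ∉′ : ∀ y → σ (punchIn (μ v) y) ∉ v ∷ R
  σ∉′ y (here eq)   = punchInᵢ≢i (μ v) y (trans (sym (μσ _)) (cong μ eq))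
  σ∉′ y (there σ∈R) = σ∉ _ σ∈R

  joins-uv : ∀ {f w} → w ∈ u ∷ R → Joins (graph (image μ g)) f (μ v) (μ w) → Joins (graph (image μ g)) f (μ v) (μ u)
  joins-uv {f} (here refl) j = j
  joins-uv {f} (there w∈R) j = subst (Joins (graph (image μ g)) f (μ v)) (root w∈R) j

-- The edge between `a` and `b` stands for e, which the reduction must leave alone; it has to
-- survive in every contraction made below. The vertex `c` rules out the case in which there is
-- nothing to find.
HasSmallVertex : ℕ → Set
HasSmallVertex n = ∀ {m} (g : Ends n m) → Connected (graph g) → ¬ HasK4Minor (graph g) →
  ∀ a b → a ≢ b → Adjacent g a b → ∀ c → c ≢ a → c ≢ b → ∃ λ w → w ≢ a × w ≢ b × Small g w

three-in-two : {A : Set} {P Q x y z : A} → x ≢ y → x ≢ z → y ≢ z →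
  x ≡ P ⊎ x ≡ Q → y ≡ P ⊎ y ≡ Q → z ≡ P ⊎ z ≡ Q → ⊥
three-in-two x≢y x≢z y≢z (inj₁ refl) (inj₁ y≡)   _           = x≢y (sym y≡)
three-in-two x≢y x≢z y≢z (inj₁ refl) (inj₂ _)    (inj₁ z≡)   = x≢z (sym z≡)
three-in-two x≢y x≢z y≢z (inj₁ _)    (inj₂ refl) (inj₂ z≡)   = y≢z (sym z≡)
three-in-two x≢y x≢z y≢z (inj₂ refl) (inj₂ y≡)   _           = x≢y (sym y≡)
three-in-two x≢y x≢z y≢z (inj₂ refl) (inj₁ _)    (inj₂ z≡)   = x≢z (sym z≡)
three-in-two x≢y x≢z y≢z (inj₂ _)    (inj₁ refl) (inj₁ z≡)   = y≢z (sym z≡)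

other-of-two : {A : Set} {P Q a : A} → a ≡ P ⊎ a ≡ Q → ∃ λ Z → ∀ y → y ≡ P ⊎ y ≡ Q → y ≡ a ⊎ y ≡ Z
other-of-two {P = P} {Q} (inj₁ refl) = Q , λ y → id
other-of-two {P = P} {Q} (inj₂ refl) = P , λ y → swap

drop-first : {A : Set} {x y : A} {B : Set} → x ≢ y → x ≡ y ⊎ B → B
drop-first x≢y (inj₁ x≡y) = contradiction x≡y x≢y
drop-first x≢y (inj₂ b)   = b

-- A minimal counterexample

module NoSmallVertex {n m} (ih : ∀ {k} → k < n → HasSmallVertex k) (g : Ends n m)
  (connected : Connected (graph g)) (noK4 : ¬ HasK4Minor (graph g))
  (a b : Fin n) (a≢b : a ≢ b) (ab : Adjacent g a b)
  (large : ∀ w → w ≢ a → w ≢ b → ¬ Small g w) where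

  -- Minimality applied to a quotient: the class of `w` sends edges to at most two other classes. As
  -- `w` itself is large in `g`, each use then asks which neighbours the contraction can have cost
  -- it.
  survivor : ∀ {r R u} (C : Collapse g (r ∷ R) u) → a ∉ r ∷ R → b ∉ r ∷ R →
    ∀ c → c ∉ r ∷ R → c ≢ a → c ≢ b →
    ∃ λ w → ∃ λ P → ∃ λ Q → w ∉ r ∷ R × w ≢ a × w ≢ b ×
      (∀ x y → Collapse.rep C x ≡ w → Adjacent g x y → Collapse.rep C y ≡ w ⊎ Collapse.rep C y ≡ P ⊎ Collapse.rep C y ≡ Q)
  survivor C a∉ b∉ c c∉ c≢a c≢b = lift (ih k<n (image μ g) (connected-image μ g (λ y → σ y , μσ y) connected) (noK4 ∘ k4)
      (μ a) (μ b) (μ-distinct a∉ b∉ a≢b) (μ-adjacent ab) (μ c) (μ-distinct c∉ a∉ c≢a) (μ-distinct c∉ b∉ c≢b))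
    where
    open Collapse C
    k<n : k < n
    k<n = subst (k <_) order (m<m+n k (s≤s Data.Nat.z≤n))
    lift : (∃ λ w → w ≢ μ a × w ≢ μ b × Small (image μ g) w) → _
    lift (w , w≢a , w≢b , p , q , small) = σ w , σ p , σ q , σ∉ w , ≢-lift w≢a , ≢-lift w≢b , nbrs
      where
      ≢-lift : ∀ {x} → w ≢ μ x → σ w ≢ x
      ≢-lift w≢ eq = w≢ (trans (sym (μσ w)) (cong μ eq))
      nbrs : ∀ x y → rep x ≡ σ w → Adjacent g x y → rep y ≡ σ w ⊎ rep y ≡ σ p ⊎ rep y ≡ σ q
      nbrs x y eq adj with small (μ y) (subst (λ z → Adjacent (image μ g) z (μ y)) (trans (sym (μσ (μ x))) (trans (cong μ eq) (μσ w))) (μ-adjacent adj))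
      ... | inj₁ e        = inj₁ (cong σ e)
      ... | inj₂ (inj₁ e) = inj₂ (inj₁ (cong σ e))
      ... | inj₂ (inj₂ e) = inj₂ (inj₂ (cong σ e))

  -- For `v` adjacent to `a`, this is a triangle on `v`, `a` and `w` in which `w` has degree three,
  -- its last neighbour being `x`.
  record Triangle (v : Fin n) : Set where
    field
      w x  : Fin n
      w≢a  : w ≢ a
      w≢b  : w ≢ b
      w≢v  : w ≢ v
      x≢w  : x ≢ w
      x≢a  : x ≢ a
      x≢v  : x ≢ v
      wa   : Adjacent g w a
      wv   : Adjacent g w v
      wx   : Adjacent g w x
      nbrs : ∀ y → Adjacent g w y → y ≡ w ⊎ y ≡ a ⊎ y ≡ v ⊎ y ≡ x

  -- Contracting v into a makes some vertex small; it must have lost a neighbour by this.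
  collapsed-triangle : ∀ v → v ≢ a → v ≢ b → Collapse g (v ∷ []) a → Triangle v
  collapsed-triangle v v≢a v≢b C with further-neighbour (large v v≢a v≢b) a b
  ... | c , _ , c≢v , c≢a , c≢b with survivor C (λ { (here e) → v≢a (sym e) }) (λ { (here e) → v≢b (sym e) }) c (λ { (here e) → c≢v e }) c≢a c≢b
  ...   | w , P , Q , w∉ , w≢a , w≢b , spec = build (adjacent? g w v)
    where
    open Collapse C
    w≢v : w ≢ v
    w≢v w≡v = w∉ (here w≡v)
    other : ∀ y → Adjacent g w y → y ≢ v → y ≡ w ⊎ y ≡ P ⊎ y ≡ Q
    other y adj y≢v = subst (λ z → z ≡ w ⊎ z ≡ P ⊎ z ≡ Q) (keep (λ { (here e) → y≢v e })) (spec w y (keep w∉) adj)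
    build : Dec (Adjacent g w v) → Triangle v
    build (no ¬wv) = contradiction (P , Q , λ y adj → other y adj (λ { refl → ¬wv adj })) (large w w≢a w≢b)
    build (yes wv) with other-of-two (drop-first (w≢a ∘ sym) (subst (λ z → z ≡ w ⊎ z ≡ P ⊎ z ≡ Q) (rep-root (here refl)) (spec w v (keep w∉) wv)))
    -- The only candidates are `a`, `v` and `Z`. A neighbour other than `a` and `v` must be `Z`, and
    -- one other than `v` and `Z` must be `a`, so all three occur.
    ... | Z , PQ⊆aZ = finish (further-neighbour (large w w≢a w≢b) a v) (further-neighbour (large w w≢a w≢b) v Z)
      where
      nbrs : ∀ y → Adjacent g w y → y ≡ w ⊎ y ≡ a ⊎ y ≡ v ⊎ y ≡ Z
      nbrs y adj with y ≟ᶠ v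
      ... | yes y≡v = inj₂ (inj₂ (inj₁ y≡v))
      ... | no y≢v with other y adj y≢v
      ...   | inj₁ y≡w = inj₁ y≡w
      ...   | inj₂ e with PQ⊆aZ y e
      ...     | inj₁ y≡a = inj₂ (inj₁ y≡a)
      ...     | inj₂ y≡Z = inj₂ (inj₂ (inj₂ y≡Z))
      finish : (∃ λ x → Adjacent g w x × x ≢ w × x ≢ a × x ≢ v) → (∃ λ x → Adjacent g w x × x ≢ w × x ≢ v × x ≢ Z) → Triangle v
      finish (x , wx , x≢w , x≢a , x≢v) (y , wy , y≢w , y≢v , y≢Z) with nbrs x wx | nbrs y wy
      ... | inj₁ e                      | _ = contradiction e x≢w
      ... | inj₂ (inj₁ e)               | _ = contradiction e x≢a
      ... | inj₂ (inj₂ (inj₁ e))        | _ = contradiction e x≢v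
      ... | inj₂ (inj₂ (inj₂ refl)) | inj₁ e                 = contradiction e y≢w
      ... | inj₂ (inj₂ (inj₂ refl)) | inj₂ (inj₂ (inj₁ e))   = contradiction e y≢v
      ... | inj₂ (inj₂ (inj₂ refl)) | inj₂ (inj₂ (inj₂ e))   = contradiction e y≢Z
      ... | inj₂ (inj₂ (inj₂ refl)) | inj₂ (inj₁ refl)       = record
        { w = w ; x = x ; w≢a = w≢a ; w≢b = w≢b ; w≢v = w≢v ; x≢w = x≢w ; x≢a = x≢a ; x≢v = x≢v
        ; wa = wy ; wv = wv ; wx = wx ; nbrs = nbrs }

  triangle : ∀ v → v ≢ a → v ≢ b → Adjacent g a v → Triangle v
  triangle v v≢a v≢b av = collapsed-triangle v v≢a v≢b
    (collapse-step (collapse-none g a) v a (λ ()) v≢a (here refl) (adjacent-sym av))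

  module Cubic (p q : Fin n) (p≢a : p ≢ a) (p≢b : p ≢ b) (q≢a : q ≢ a) (q≢b : q ≢ b) (p≢q : p ≢ q)
    (pa : Adjacent g p a) (qa : Adjacent g q a) (pq : Adjacent g p q) where

    -- Contracting `q` into `p` costs a neighbour only to common neighbours of the two, and as `x`
    -- and `y` differ, `a` is the only one. The merged vertex itself keeps the three neighbours `a`,
    -- `x` and `y`.
    apart : Collapse g (q ∷ []) p → ∀ x y → x ≢ p → x ≢ a → x ≢ q → y ≢ q → y ≢ a → y ≢ p → x ≢ y → Adjacent g p x → Adjacent g q y →
      (∀ z → Adjacent g p z → z ≡ p ⊎ z ≡ a ⊎ z ≡ q ⊎ z ≡ x) →
      (∀ z → Adjacent g q z → z ≡ q ⊎ z ≡ a ⊎ z ≡ p ⊎ z ≡ y) → ⊥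
    apart C x y x≢p x≢a x≢q y≢q y≢a y≢p x≢y px qy p-nbrs q-nbrs
      with survivor C (λ { (here e) → q≢a (sym e) }) (λ { (here e) → q≢b (sym e) }) p (λ { (here e) → p≢q e }) p≢a p≢b
    ... | w , P , Q , w∉ , w≢a , w≢b , spec = absurd (w ≟ᶠ p) (adjacent? g w q)
      where
      open Collapse C
      kept : ∀ {z} → z ≢ q → rep z ≡ z
      kept z≢q = keep (λ { (here e) → z≢q e })
      other : ∀ z → Adjacent g w z → z ≢ q → z ≡ w ⊎ z ≡ P ⊎ z ≡ Q
      other z adj z≢q = subst (λ z → z ≡ w ⊎ z ≡ P ⊎ z ≡ Q) (kept z≢q) (spec w z (keep w∉) adj)
      absurd : Dec (w ≡ p) → Dec (Adjacent g w q) → ⊥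
      absurd (yes refl) _ = three-in-two (x≢a ∘ sym) (y≢a ∘ sym) x≢y
        (drop-first (p≢a ∘ sym) (other a pa (q≢a ∘ sym)))
        (drop-first x≢p (other x px x≢q))
        (drop-first y≢p (subst (λ z → z ≡ w ⊎ z ≡ P ⊎ z ≡ Q) (kept y≢q) (spec q y (rep-root (here refl)) qy)))
      absurd (no w≢p) (no ¬wq) = large w w≢a w≢b (P , Q , λ z adj → other z adj (λ { refl → ¬wq adj }))
      absurd (no w≢p) (yes wq) with q-nbrs w (adjacent-sym wq)
      ... | inj₁ e               = w∉ (here e)
      ... | inj₂ (inj₁ e)        = w≢a e
      ... | inj₂ (inj₂ (inj₁ e)) = w≢p e
      -- Now `w` is `y`. It is adjacent to the merged vertex through `q` alone, which leaves it the
      -- neighbours `q` and `Z`.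
      ... | inj₂ (inj₂ (inj₂ refl))
        with other-of-two (drop-first (w≢p ∘ sym) (subst (λ z → z ≡ w ⊎ z ≡ P ⊎ z ≡ Q) (rep-root (here refl)) (spec w q (keep w∉) wq)))
      ...   | Z , PQ⊆pZ = large w w≢a w≢b (q , Z , nbrs)
        where
        nbrs : ∀ z → Adjacent g w z → z ≡ w ⊎ z ≡ q ⊎ z ≡ Z
        nbrs z adj with z ≟ᶠ q
        ... | yes z≡q = inj₂ (inj₁ z≡q)
        ... | no z≢q with other z adj z≢q
        ...   | inj₁ z≡w = inj₁ z≡w
        ...   | inj₂ e with PQ⊆pZ z e
        ...     | inj₂ z≡Z  = inj₂ (inj₂ z≡Z)
        ...     | inj₁ refl with p-nbrs w (adjacent-sym adj)
        ...       | inj₁ e               = contradiction e y≢p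
        ...       | inj₂ (inj₁ e)        = contradiction e y≢a
        ...       | inj₂ (inj₂ (inj₁ e)) = contradiction e y≢q
        ...       | inj₂ (inj₂ (inj₂ e)) = contradiction (sym e) x≢y

    module Twins (x : Fin n) (x≢p : x ≢ p) (x≢a : x ≢ a) (x≢q : x ≢ q) (px : Adjacent g p x) (qx : Adjacent g q x)
      (p-nbrs : ∀ z → Adjacent g p z → z ≡ p ⊎ z ≡ a ⊎ z ≡ q ⊎ z ≡ x)
      (q-nbrs : ∀ z → Adjacent g q z → z ≡ q ⊎ z ≡ a ⊎ z ≡ p ⊎ z ≡ x) where

      xa-apart : ¬ Adjacent g x a
      xa-apart xa = noK4 (k4-four (p≢a ∘ sym) (q≢a ∘ sym) (x≢a ∘ sym) p≢q (x≢p ∘ sym) (x≢q ∘ sym)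
        (adjacent-sym pa) (adjacent-sym qa) (adjacent-sym xa) pq px qx)

      x≢b : x ≢ b
      x≢b refl = xa-apart (adjacent-sym ab)

      far : ∀ w → w ≢ p → w ≢ q → w ≢ a → w ≢ x → ¬ Adjacent g w p × ¬ Adjacent g w q
      far w w≢p w≢q w≢a w≢x = not-p ∘ p-nbrs w ∘ adjacent-sym , not-q ∘ q-nbrs w ∘ adjacent-sym
        where
        not-p : w ≡ p ⊎ w ≡ a ⊎ w ≡ q ⊎ w ≡ x → ⊥
        not-p = [ w≢p , [ w≢a , [ w≢q , w≢x ]′ ]′ ]′
        not-q : w ≡ q ⊎ w ≡ a ⊎ w ≡ p ⊎ w ≡ x → ⊥
        not-q = [ w≢q , [ w≢a , [ w≢p , w≢x ]′ ]′ ]′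

      pq∌ : ∀ {z} → z ≢ p → z ≢ q → z ∉ p ∷ q ∷ []
      pq∌ z≢p z≢q (here e)         = z≢p e
      pq∌ z≢p z≢q (there (here e)) = z≢q e

      pqx∌ : ∀ {z} → z ≢ p → z ≢ q → z ≢ x → z ∉ p ∷ q ∷ x ∷ []
      pqx∌ z≢p z≢q z≢x (here e)                 = z≢p e
      pqx∌ z≢p z≢q z≢x (there (here e))         = z≢q e
      pqx∌ z≢p z≢q z≢x (there (there (here e))) = z≢x e

      -- Contracting p and q into x can only make x small.
      x-degree : Collapse g (p ∷ q ∷ []) x → ∃ λ Z → ∀ y → Adjacent g x y → y ≡ x ⊎ y ≡ p ⊎ y ≡ q ⊎ y ≡ Z
      x-degree C with survivor C (pq∌ (p≢a ∘ sym) (q≢a ∘ sym)) (pq∌ (p≢b ∘ sym) (q≢b ∘ sym)) x (pq∌ x≢p x≢q) x≢a x≢b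
      ... | w , P , Q , w∉ , w≢a , w≢b , spec = conclude (w ≟ᶠ x)
        where
        open Collapse C
        other : ∀ v z → rep v ≡ w → Adjacent g v z → z ≢ p → z ≢ q → z ≡ w ⊎ z ≡ P ⊎ z ≡ Q
        other v z eq adj z≢p z≢q = subst (λ z → z ≡ w ⊎ z ≡ P ⊎ z ≡ Q) (keep (pq∌ z≢p z≢q)) (spec v z eq adj)
        conclude : Dec (w ≡ x) → _
        conclude (no w≢x) = ⊥-elim (large w w≢a w≢b (P , Q , λ z adj →
          other w z (keep w∉) adj (λ { refl → proj₁ w-far adj }) (λ { refl → proj₂ w-far adj })))
          where w-far = far w (w∉ ∘ here) (w∉ ∘ there ∘ here) w≢a w≢x
        -- Through `p` the merged vertex is adjacent to `a`, so `a` fills one of its two places. As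
        -- `x` itself is not adjacent to `a`, one vertex `Z` is left besides `p` and `q`.
        conclude (yes refl) with other-of-two (drop-first (w≢a ∘ sym) (other p a (rep-root (here refl)) pa (p≢a ∘ sym) (q≢a ∘ sym)))
        ... | Z , PQ⊆aZ = Z , nbrs
          where
          nbrs : ∀ y → Adjacent g x y → y ≡ x ⊎ y ≡ p ⊎ y ≡ q ⊎ y ≡ Z
          nbrs y adj with y ≟ᶠ p | y ≟ᶠ q
          ... | yes y≡p | _       = inj₂ (inj₁ y≡p)
          ... | no _    | yes y≡q = inj₂ (inj₂ (inj₁ y≡q))
          ... | no y≢p  | no y≢q with other x y (keep w∉) adj y≢p y≢q
          ...   | inj₁ y≡x = inj₁ y≡x
          ...   | inj₂ e with PQ⊆aZ y e
          ...     | inj₁ refl = contradiction adj xa-apart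
          ...     | inj₂ y≡Z  = inj₂ (inj₂ (inj₂ y≡Z))

      -- The vertices `p`, `q`, `x` have no neighbours outside their own set except `a` and `Z`. So
      -- contracting them into `Z` costs no vertex but `a` and `Z` a neighbour, and `Z` merely
      -- exchanges `x` for `a`.
      module Tail (Z : Fin n) (x-nbrs : ∀ y → Adjacent g x y → y ≡ x ⊎ y ≡ p ⊎ y ≡ q ⊎ y ≡ Z)
        (xZ : Adjacent g x Z) (Z≢x : Z ≢ x) (Z≢p : Z ≢ p) (Z≢q : Z ≢ q) where

        Z≢a : Z ≢ a
        Z≢a refl = xa-apart xZ

        C₁ : Collapse g (x ∷ []) Z
        C₁ = collapse-step (collapse-none g Z) x Z (λ ()) (Z≢x ∘ sym) (here refl) xZ

        -- With `x` contracted into `Z`, both `p` and `q` become adjacent to `Z`, and an edge from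
        -- `Z` to `a` would complete a K4 on `a`, `p`, `q`, `Z`.
        clique : Collapse g (x ∷ []) Z → ¬ Adjacent g Z a
        clique C Za = noK4 (k4 (k4-four
          (distinct (x≢a ∘ sym) (x≢p ∘ sym) (p≢a ∘ sym)) (distinct (x≢a ∘ sym) (x≢q ∘ sym) (q≢a ∘ sym)) (distinct (x≢a ∘ sym) Z≢x (Z≢a ∘ sym))
          (distinct (x≢p ∘ sym) (x≢q ∘ sym) p≢q) (distinct (x≢p ∘ sym) Z≢x (Z≢p ∘ sym)) (distinct (x≢q ∘ sym) Z≢x (Z≢q ∘ sym))
          (μ-adjacent (adjacent-sym pa)) (μ-adjacent (adjacent-sym qa)) (μ-adjacent (adjacent-sym Za)) (μ-adjacent pq)
          (to-Z px) (to-Z qx)))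
          where
          open Collapse C
          distinct : ∀ {y z} → y ≢ x → z ≢ x → y ≢ z → μ y ≢ μ z
          distinct y≢x z≢x = μ-distinct (λ { (here e) → y≢x e }) (λ { (here e) → z≢x e })
          to-Z : ∀ {y} → Adjacent g y x → Adjacent (image μ g) (μ y) (μ Z)
          to-Z adj = subst (Adjacent (image μ g) _) (root (here refl)) (μ-adjacent adj)

        Za-apart : ¬ Adjacent g Z a
        Za-apart = clique C₁

        Z≢b : Z ≢ b
        Z≢b refl = Za-apart (adjacent-sym ab)

        collapsed-absurd : Collapse g (p ∷ q ∷ x ∷ []) Z → ⊥
        collapsed-absurd C with survivor C (pqx∌ (p≢a ∘ sym) (q≢a ∘ sym) (x≢a ∘ sym)) (pqx∌ (p≢b ∘ sym) (q≢b ∘ sym) (x≢b ∘ sym)) Z (pqx∌ Z≢p Z≢q Z≢x) Z≢a Z≢b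
        ... | w , P , Q , w∉ , w≢a , w≢b , spec = absurd (w ≟ᶠ Z)
          where
          open Collapse C
          w≢p : w ≢ p
          w≢p = w∉ ∘ here
          w≢q : w ≢ q
          w≢q = w∉ ∘ there ∘ here
          w≢x : w ≢ x
          w≢x = w∉ ∘ there ∘ there ∘ here
          w-far = far w w≢p w≢q w≢a w≢x
          other : ∀ v z → rep v ≡ w → Adjacent g v z → z ≢ p → z ≢ q → z ≢ x → z ≡ w ⊎ z ≡ P ⊎ z ≡ Q
          other v z eq adj z≢p z≢q z≢x = subst (λ z → z ≡ w ⊎ z ≡ P ⊎ z ≡ Q) (keep (pqx∌ z≢p z≢q z≢x)) (spec v z eq adj)
          absurd : Dec (w ≡ Z) → ⊥
          absurd (no w≢Z) = large w w≢a w≢b (P , Q , λ z adj → other w z (keep w∉) adj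
            (λ { refl → proj₁ w-far adj }) (λ { refl → proj₂ w-far adj })
            (λ { refl → [ w≢x , [ w≢p , [ w≢q , w≢Z ]′ ]′ ]′ (x-nbrs w (adjacent-sym adj)) }))
          absurd (yes refl) with other-of-two (drop-first (w≢a ∘ sym) (other p a (rep-root (here refl)) pa (p≢a ∘ sym) (q≢a ∘ sym) (x≢a ∘ sym)))
          ... | Y , PQ⊆aY = large Z Z≢a Z≢b (x , Y , nbrs)
            where
            nbrs : ∀ z → Adjacent g Z z → z ≡ Z ⊎ z ≡ x ⊎ z ≡ Y
            nbrs z adj with z ≟ᶠ x
            ... | yes z≡x = inj₂ (inj₁ z≡x)
            ... | no z≢x with other Z z (keep w∉) adj (λ { refl → proj₁ w-far adj }) (λ { refl → proj₂ w-far adj }) z≢x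
            ...   | inj₁ z≡Z = inj₁ z≡Z
            ...   | inj₂ e with PQ⊆aY z e
            ...     | inj₁ refl = contradiction adj Za-apart
            ...     | inj₂ z≡Y  = inj₂ (inj₂ z≡Y)

        tail-absurd : ⊥
        tail-absurd = collapsed-absurd
          (collapse-step (collapse-step C₁ q x (λ { (here e) → x≢q (sym e) }) (Z≢q ∘ sym) (there (here refl)) qx)
            p x (λ { (here e) → p≢q e ; (there (here e)) → x≢p (sym e) }) (Z≢p ∘ sym) (there (there (here refl))) px)

      twins-absurd : ⊥
      twins-absurd with x-degree (collapse-step (collapse-step (collapse-none g x) q x (λ ()) (x≢q ∘ sym) (here refl) qx)
                                    p x (λ { (here e) → p≢q e }) (x≢p ∘ sym) (here refl) px)
      ... | Z , x-nbrs with further-neighbour (large x x≢a x≢b) p q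
      ...   | y , xy , y≢x , y≢p , y≢q with x-nbrs y xy
      ...     | inj₁ e                  = y≢x e
      ...     | inj₂ (inj₁ e)           = y≢p e
      ...     | inj₂ (inj₂ (inj₁ e))    = y≢q e
      ...     | inj₂ (inj₂ (inj₂ refl)) = Tail.tail-absurd Z x-nbrs xy y≢x y≢p y≢q

    cubic-absurd : ∀ x y → x ≢ p → x ≢ a → x ≢ q → y ≢ q → y ≢ a → y ≢ p → Adjacent g p x → Adjacent g q y →
      (∀ z → Adjacent g p z → z ≡ p ⊎ z ≡ a ⊎ z ≡ q ⊎ z ≡ x) →
      (∀ z → Adjacent g q z → z ≡ q ⊎ z ≡ a ⊎ z ≡ p ⊎ z ≡ y) → ⊥
    cubic-absurd x y x≢p x≢a x≢q y≢q y≢a y≢p px qy p-nbrs q-nbrs with x ≟ᶠ y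
    ... | no x≢y   = apart (collapse-step (collapse-none g p) q p (λ ()) (p≢q ∘ sym) (here refl) (adjacent-sym pq))
                       x y x≢p x≢a x≢q y≢q y≢a y≢p x≢y px qy p-nbrs q-nbrs
    ... | yes refl = Twins.twins-absurd x x≢p x≢a x≢q px qy p-nbrs q-nbrs

  -- The apex of the second triangle is a neighbour of `T₁.w` other than `a`, hence `v` or `T₁.x`.
  -- Whichever of the two it is not becomes the third neighbour of `T₁.w`.
  two-triangles : ∀ v → v ≢ a → (T₁ : Triangle v) → Triangle (Triangle.w T₁) → ⊥
  two-triangles v v≢a T₁ T₂ = meet (T₁.nbrs T₂.w (adjacent-sym T₂.wv))
    where
    module T₁ = Triangle T₁
    module T₂ = Triangle T₂
    open Cubic T₁.w T₂.w T₁.w≢a T₁.w≢b T₂.w≢a T₂.w≢b (T₂.w≢v ∘ sym) T₁.wa T₂.wa (adjacent-sym T₂.wv)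
    meet : T₂.w ≡ T₁.w ⊎ T₂.w ≡ a ⊎ T₂.w ≡ v ⊎ T₂.w ≡ T₁.x → ⊥
    meet (inj₁ e)               = T₂.w≢v e
    meet (inj₂ (inj₁ e))        = T₂.w≢a e
    meet (inj₂ (inj₂ (inj₁ e))) = cubic-absurd T₁.x T₂.x T₁.x≢w T₁.x≢a (λ e′ → T₁.x≢v (trans e′ e)) T₂.x≢w T₂.x≢a T₂.x≢v T₁.wx T₂.wx
      (λ z adj → subst (λ t → z ≡ T₁.w ⊎ z ≡ a ⊎ z ≡ t ⊎ z ≡ T₁.x) (sym e) (T₁.nbrs z adj)) T₂.nbrs
    meet (inj₂ (inj₂ (inj₂ e))) = cubic-absurd v T₂.x (T₁.w≢v ∘ sym) v≢a (λ e′ → T₁.x≢v (sym (trans e′ e))) T₂.x≢w T₂.x≢a T₂.x≢v T₁.wv T₂.wx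
      (λ z adj → subst (λ t → z ≡ T₁.w ⊎ z ≡ a ⊎ z ≡ t ⊎ z ≡ v) (sym e) (reorder (T₁.nbrs z adj))) T₂.nbrs
      where
      reorder : ∀ {A B C D : Set} → A ⊎ B ⊎ C ⊎ D → A ⊎ B ⊎ D ⊎ C
      reorder (inj₁ p)               = inj₁ p
      reorder (inj₂ (inj₁ p))        = inj₂ (inj₁ p)
      reorder (inj₂ (inj₂ (inj₁ p))) = inj₂ (inj₂ (inj₂ p))
      reorder (inj₂ (inj₂ (inj₂ p))) = inj₂ (inj₂ (inj₁ p))

  neighbour-absurd : ∀ v → v ≢ a → v ≢ b → Adjacent g a v → ⊥
  neighbour-absurd v v≢a v≢b av = two-triangles v v≢a T (triangle (w T) (w≢a T) (w≢b T) (adjacent-sym (wa T)))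
    where
    open Triangle
    T = triangle v v≢a v≢b av

reach-closed : ∀ {n m} {g : Ends n m} (S : Fin n → Set) → (∀ x y → S x → Adjacent g x y → S y) →
  ∀ {P x y} → Reach (graph g) P x y → S x → S y
reach-closed S closed here           s = s
reach-closed S closed (step f _ j r) s = reach-closed S closed r (closed _ _ s (f , j))

small-vertex : ∀ n → HasSmallVertex n
small-vertex = <-rec HasSmallVertex (λ n ih → case-small n ih)
  where
  case-small : ∀ n → (∀ {k} → k < n → HasSmallVertex k) → HasSmallVertex n
  case-small n ih g conn noK4 a b a≢b ab c c≢a c≢b
    with any? (λ w → ¬? (w ≟ᶠ a) ×-dec (¬? (w ≟ᶠ b) ×-dec small? g w))
  ... | yes small = small
  -- Neither `a` nor `b` has a neighbour outside the two of them, so by connectedness `c` cannot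
  -- exist.
  ... | no none   = ⊥-elim ([ c≢a , c≢b ]′ (reach-closed (λ x → x ≡ a ⊎ x ≡ b) closed (conn a c) (inj₁ refl)))
    where
    large : ∀ w → w ≢ a → w ≢ b → ¬ Small g w
    large w w≢a w≢b small = none (w , w≢a , w≢b , small)
    closed : ∀ x y → x ≡ a ⊎ x ≡ b → Adjacent g x y → y ≡ a ⊎ y ≡ b
    closed x y x∈ xy with y ≟ᶠ a | y ≟ᶠ b
    ... | yes y≡a | _       = inj₁ y≡a
    ... | no _    | yes y≡b = inj₂ y≡b
    closed x y (inj₁ refl) xy | no y≢a | no y≢b =
      ⊥-elim (NoSmallVertex.neighbour-absurd ih g conn noK4 a b a≢b ab large y y≢a y≢b xy)
    closed x y (inj₂ refl) xy | no y≢a | no y≢b =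
      ⊥-elim (NoSmallVertex.neighbour-absurd ih g conn noK4 b a (a≢b ∘ sym) (adjacent-sym ab) (λ w w≢b w≢a → large w w≢a w≢b) y y≢b y≢a xy)

-- Spanning trees under exchange and contraction

Tree : ∀ {n m} → Ends n m → (Fin m → Set) → Set
Tree g T = IsSpanningTree (graph g) T

Parallel : ∀ {n m} → Ends n m → Fin m → Fin m → Set
Parallel g f f′ = Joins (graph g) f′ (src g f) (tgt g f)

Incident : ∀ {n m} → Ends n m → Fin n → Fin m → Set
Incident g v f = src g f ≡ v ⊎ tgt g f ≡ v

reach-ends-cong : ∀ {n m} {g g′ : Ends n m} {P : Fin m → Set} → (∀ f → P f → g f ≡ g′ f) →
  ∀ {x y} → Reach (graph g) P x y → Reach (graph g′) P x y
reach-ends-cong eq here               = here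
reach-ends-cong eq (step f p (inj₁ j) r) = step f p (inj₁ (trans (sym (eq f p)) j)) (reach-ends-cong eq r)
reach-ends-cong eq (step f p (inj₂ j) r) = step f p (inj₂ (trans (sym (eq f p)) j)) (reach-ends-cong eq r)

tree-ends-cong : ∀ {n m} {g g′ : Ends n m} {T : Fin m → Set} → (∀ f → T f → g f ≡ g′ f) → Tree g T → Tree g′ T
tree-ends-cong {g = g} {g′} {T} eq (conn , acyclic) = (λ x y → reach-ends-cong eq (conn x y)) , acyclic′
  where
  acyclic′ : ∀ f → T f → ¬ Reach (graph g′) (Without (graph g′) T f) (src g′ f) (tgt g′ f)
  acyclic′ f t r = acyclic f t (subst (λ e → Reach (graph g) (Without (graph g) T f) (proj₁ e) (proj₂ e)) (sym (eq f t))
    (reach-ends-cong (λ h p → sym (eq h (proj₁ p))) r))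

module _ {n m : ℕ} {g : Ends n m} where

  joins-parallel : ∀ {f f′ x y} → Joins (graph g) f x y → Joins (graph g) f′ x y → Parallel g f f′
  joins-parallel {f} {f′} j j′ with joins-cases {g = g} {f} j
  ... | inj₁ (refl , refl) = j′
  ... | inj₂ (refl , refl) = swap j′

  incident-joins : ∀ {v f} → Incident g v f → ∃ λ u → Joins (graph g) f v u
  incident-joins {v} {f} (inj₁ refl) = tgt g f , inj₁ refl
  incident-joins {v} {f} (inj₂ refl) = src g f , inj₂ refl

  joins-incident : ∀ {v u f} → Joins (graph g) f v u → Incident g v f
  joins-incident {f = f} j with joins-cases {g = g} {f} j
  ... | inj₁ (refl , _) = inj₁ refl
  ... | inj₂ (_ , refl) = inj₂ refl

  tree-cong : ∀ {T T′ : Fin m → Set} → (∀ f → T f → T′ f) → (∀ f → T′ f → T f) → Tree g T → Tree g T′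
  tree-cong to from (conn , acyclic) = (λ x y → reach-mono to (conn x y)) ,
    λ f t r → acyclic f (from f t) (reach-mono (λ h p → from h (proj₁ p) , proj₂ p) r)

  tree-no-loop : ∀ {T : Fin m → Set} → Tree g T → ∀ {f} → T f → src g f ≢ tgt g f
  tree-no-loop {T} (_ , acyclic) {f} t loop =
    acyclic f t (subst (Reach (graph g) (Without (graph g) T f) (src g f)) loop here)

  tree-no-parallel : ∀ {T : Fin m → Set} → Tree g T → ∀ {f f′} → f ≢ f′ → Parallel g f f′ → T f → ¬ T f′
  tree-no-parallel (_ , acyclic) {f} {f′} f≢f′ par t t′ = acyclic f t (reach-edge f′ (t′ , f≢f′ ∘ sym) par)

  tree-incident : ∀ {T : Fin m → Set} → Tree g T → ∀ {v s} → v ≢ s → ∃ λ f → T f × Incident g v f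
  tree-incident (conn , _) {v} {s} v≢s with conn v s
  ... | here         = contradiction refl v≢s
  ... | step f t j _ = f , t , joins-incident {f = f} j

  -- Walks may use either of two parallel edges. The exchanged set is described by inclusions, so
  -- that it covers an exchange within `l` as well as one of the edge added to `l`.
  tree-exchange : ∀ {T T′ : Fin m → Set} {f f′} → Tree g T → T f → f ≢ f′ → Parallel g f f′ → T′ f′ →
    (∀ h → T h → h ≢ f → T′ h) → (∀ h → T′ h → h ≡ f′ ⊎ (T h × h ≢ f)) → Tree g T′
  tree-exchange {T} {T′} {f} {f′} (conn , acyclic) tf f≢f′ par t′f′ to from = conn′ , acyclic′
    where
    parallel-reach : ∀ {P : Fin m → Set} → Reach (graph g) P (src g f′) (tgt g f′) → Reach (graph g) P (src g f) (tgt g f)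
    parallel-reach r with joins-cases {g = g} {f′} par
    ... | inj₁ (s , t) = subst₂ (Reach (graph g) _) s t r
    ... | inj₂ (s , t) = reach-sym (subst₂ (Reach (graph g) _) s t r)

    conn′ : ∀ x y → Reach (graph g) T′ x y
    conn′ x y = reach-bind edge (conn x y)
      where
      edge : ∀ h → T h → Reach (graph g) T′ (src g h) (tgt g h)
      edge h th with h ≟ᶠ f
      ... | yes refl = reach-edge f′ t′f′ par
      ... | no h≢f   = reach-edge h (to h th h≢f) (joins-ends {g = g} h)

    acyclic-new : ¬ Reach (graph g) (Without (graph g) T′ f′) (src g f′) (tgt g f′)
    acyclic-new r = acyclic f tf (parallel-reach (reach-mono old r))
      where
      old : ∀ h → Without (graph g) T′ f′ h → Without (graph g) T f h
      old h (t′ , h≢f′) with from h t′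
      ... | inj₁ h≡f′ = contradiction h≡f′ h≢f′
      ... | inj₂ th   = th

    acyclic′ : ∀ h → T′ h → ¬ Reach (graph g) (Without (graph g) T′ h) (src g h) (tgt g h)
    acyclic′ h t′ r with from h t′
    ... | inj₁ refl       = acyclic-new r
    ... | inj₂ (th , h≢f) = acyclic h th (reach-bind edge r)
      where
      edge : ∀ k → Without (graph g) T′ h k → Reach (graph g) (Without (graph g) T h) (src g k) (tgt g k)
      edge k (t′k , k≢h) with from k t′k
      ... | inj₂ (tk , _) = reach-edge k (tk , k≢h) (joins-ends {g = g} k)
      ... | inj₁ refl with joins-cases {g = g} {f′} par
      ...   | inj₁ (s , t) = reach-edge f (tf , h≢f ∘ sym) (inj₁ (cong₂ _,_ (sym s) (sym t)))
      ...   | inj₂ (s , t) = reach-edge f (tf , h≢f ∘ sym) (inj₂ (cong₂ _,_ (sym t) (sym s)))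

module _ {n m : ℕ} {g : Ends (suc n) m} where

  -- Connectedness passes to the image. A cycle in the image would lift to one in `T`, with `x`
  -- bridging the gaps at the merged vertex.
  tree-contract : ∀ {T : Fin m → Set} {v u x} (v≢u : v ≢ u) → Joins (graph g) x v u → Tree g T → T x →
    Tree (image (Merge.merge v u v≢u) g) (Without (graph g) T x)
  tree-contract {T} {v} {u} {x} v≢u j (conn , acyclic) tx = conn′ , acyclic′
    where
    open Merge v u v≢u
    collapsed : merge (src g x) ≡ merge (tgt g x)
    collapsed with joins-cases {g = g} {x} j
    ... | inj₁ (refl , refl) = merge-same
    ... | inj₂ (refl , refl) = sym merge-same
    keep-or-collapse : ∀ f → T f → Without (graph g) T x f ⊎ merge (src g f) ≡ merge (tgt g f)
    keep-or-collapse f tf with f ≟ᶠ x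
    ... | yes refl = inj₂ collapsed
    ... | no f≢x   = inj₁ (tf , f≢x)
    conn′ : ∀ p q → Reach (graph (image merge g)) (Without (graph g) T x) p q
    conn′ p q = subst₂ (Reach (graph (image merge g)) (Without (graph g) T x)) (merge-punchIn p) (merge-punchIn q)
      (reach-image merge g keep-or-collapse (conn (punchIn v p) (punchIn v q)))
    acyclic′ : ∀ f → Without (graph g) T x f →
      ¬ Reach (graph (image merge g)) (Without (graph g) (Without (graph g) T x) f) (merge (src g f)) (merge (tgt g f))
    acyclic′ f (tf , f≢x) r = acyclic f tf (reach-lift merge g (λ _ → ⊤) (λ a b eq _ → fibre-reach x (tx , f≢x ∘ sym) j a b eq)
      (λ { h ((th , _) , h≢f) → (th , h≢f) , tt , tt }) r (src g f) (tgt g f) refl refl tt)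

  -- As v is a leaf of T, merging it into any vertex has the same effect on T − y as contracting y.
  tree-contract-leaf : ∀ {T : Fin m → Set} {v u w y} (v≢u : v ≢ u) → v ≢ w → Joins (graph g) y v w → Tree g T → T y →
    (∀ f → T f → Incident g v f → f ≡ y) → Tree (image (Merge.merge v u v≢u) g) (Without (graph g) T y)
  tree-contract-leaf {T} {v} {u} {w} {y} v≢u v≢w j tree ty leaf = tree-ends-cong same (tree-contract v≢w j tree ty)
    where
    module U = Merge v u v≢u
    module W = Merge v w v≢w
    agree : ∀ {z} → z ≢ v → W.merge z ≡ U.merge z
    agree z≢v = punchIn-injective v _ _ (trans (W.punchIn-merge z≢v) (sym (U.punchIn-merge z≢v)))
    same : ∀ f → Without (graph g) T y f → image W.merge g f ≡ image U.merge g f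
    same f (tf , f≢y) = cong₂ _,_ (agree (f≢y ∘ leaf f tf ∘ inj₁)) (agree (f≢y ∘ leaf f tf ∘ inj₂))

-- Patterns of positive Sidorenko-type density

DirectedEdges : ℕ → Set
DirectedEdges n = Vec Bool n → Fin n → Bool

indicator : Bool → ℕ
indicator b = if b then 1 else 0

indicator≤1 : ∀ b → indicator b ≤ 1
indicator≤1 true  = s≤s z≤n
indicator≤1 false = z≤n

edges : ∀ {n} → DirectedEdges n → ℕ
edges {n} D = ∑ (allVecs n) (λ z → ∑ (allFin n) (λ i → indicator (D z i)))

Pattern : ℕ → Set₁
Pattern m = Vec Bool m → Fin m → Set

Hits : ∀ {n m} → DirectedEdges n → Pattern m → Vec Bool n → Vec (Fin n) m → Set
Hits D Y z φ = ∀ l h → Y l h → D (act z φ l) (lookup φ h) ≡ true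

-- With C for the exponent, bound says that a random homomorphic copy of Y lies in D with
-- probability at least (density of D)^C.
record Packing {n m} (Y : Pattern m) (X : Vec Bool m) (C : ℕ) (D : DirectedEdges n) : Set where
  field
    weight  : Weight n m
    ≤1      : ∀ z φ → weight z φ ≤ 1
    ignores : ∀ k → lookup X k ≡ false → ∀ z φ i → weight z (φ [ k ]≔ i) ≡ weight z φ
    hits    : ∀ z φ → weight z φ ≢ 0 → Hits D Y z φ
    bound   : edges D ^ C * mass n m ≤ (2 ^ n * n) ^ C * total weight

-- The exponent `C` is fixed before `n` and `D`, because ε will be 1/C.
Abundant : ∀ {m} → Pattern m → Vec Bool m → Set
Abundant Y X = ∃ λ C → 1 ≤ C × (∀ n → .{{NonZero n}} → (D : DirectedEdges n) → Packing Y X C D)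

edges-bound : ∀ {n} (D : DirectedEdges n) → edges D ≤ 2 ^ n * n
edges-bound {n} D = begin
  edges D                                                 ≤⟨ ∑-mono (allVecs n) (λ z → ∑-mono (allFin n) (λ i → indicator≤1 (D z i))) ⟩
  ∑ (allVecs n) (λ _ → ∑ (allFin n) (λ _ → 1))            ≡⟨ ∑-cong (allVecs n) (λ _ → trans (∑-allFin-const n 1) (*-identityʳ n)) ⟩
  ∑ (allVecs n) (λ _ → n)                                 ≡⟨ ∑-allVecs-const n n ⟩
  2 ^ n * n                                               ∎
  where open ≤-Reasoning

abundant-empty : ∀ {m} {Y : Pattern m} {X} → (∀ l h → ¬ Y l h) → Abundant Y X
abundant-empty {m} {Y} {X} empty = 1 , s≤s z≤n , packing
  where
  packing : ∀ n → .{{NonZero n}} → (D : DirectedEdges n) → Packing Y X 1 D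
  packing n D = record
    { weight  = λ _ _ → 1
    ; ≤1      = λ _ _ → s≤s z≤n
    ; ignores = λ _ _ _ _ _ → refl
    ; hits    = λ _ _ _ l h y → contradiction y (empty l h)
    ; bound   = *-mono-≤ (^-monoˡ-≤ 1 (edges-bound D)) (≤-reflexive (sym (total-one n m)))
    }

-- The pattern is a single edge leaving the base vertex, so it is hit with probability exactly the
-- density of `D`.
abundant-single : ∀ {m} {Y : Pattern m} {X} k → lookup X k ≡ true →
  (∀ l h → Y l h → h ≡ k × (∀ i → lookup l i ≡ false)) → Abundant Y X
abundant-single {m} {Y} {X} k k∈X single = 1 , s≤s z≤n , packing
  where
  packing : ∀ n → .{{NonZero n}} → (D : DirectedEdges n) → Packing Y X 1 D
  packing n D = record
    { weight  = w
    ; ≤1      = λ z φ → indicator≤1 (D z (lookup φ k))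
    ; ignores = λ i i∉X z φ j → cong (λ x → indicator (D z x)) (lookup∘update′ {i = k} {i} (λ { refl → contradiction (trans (sym k∈X) i∉X) (λ ()) }) φ j)
    ; hits    = hits
    ; bound   = bound
    }
    where
    w : Weight n m
    w z φ = indicator (D z (lookup φ k))
    hits : ∀ z φ → w z φ ≢ 0 → Hits D Y z φ
    hits z φ w≢0 l h y with single l h y
    ... | refl , empty with D z (lookup φ k) in eq
    ...   | true  = trans (cong (λ x → D x (lookup φ k)) (act-empty z φ l empty)) eq
    ...   | false = contradiction refl w≢0
    bound : edges D ^ 1 * mass n m ≤ (2 ^ n * n) ^ 1 * total w
    bound = ≤-reflexive (begin
      edges D ^ 1 * (2 ^ n * n ^ m)     ≡⟨ solve 3 (λ e a b → e :* con 1 :* (a :* b) := a :* (b :* e)) refl (edges D) (2 ^ n) (n ^ m) ⟩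
      2 ^ n * (n ^ m * edges D)         ≡⟨ cong (2 ^ n *_) (sym (total-mean (λ z i → indicator (D z i)) k)) ⟩
      2 ^ n * (n * total w)             ≡⟨ solve 3 (λ a b t → a :* (b :* t) := a :* b :* con 1 :* t) refl (2 ^ n) n (total w) ⟩
      (2 ^ n * n) ^ 1 * total w         ∎)
      where open ≡-Reasoning
            open +-*-Solver

-- With δ = a/K, from t ≥ δ^C T and t² ≤ T t′ it follows that t′ ≥ δ^(2C) T. Here the exponent
-- doubles.
bound-square : ∀ {a K C T t t′} .{{_ : NonZero T}} → a ^ C * T ≤ K ^ C * t → t * t ≤ T * t′ →
  a ^ (C + C) * T ≤ K ^ (C + C) * t′
bound-square {a} {K} {C} {T} {t} {t′} bound square = *-cancelʳ-≤ _ _ T (begin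
  a ^ (C + C) * T * T             ≡⟨ cong (λ x → x * T * T) (^-distribˡ-+-* a C C) ⟩
  A * A * T * T                   ≡⟨ solve 2 (λ a t → a :* a :* t :* t := (a :* t) :* (a :* t)) refl A T ⟩
  (A * T) * (A * T)               ≤⟨ *-mono-≤ bound bound ⟩
  (B * t) * (B * t)               ≡⟨ solve 2 (λ b t → (b :* t) :* (b :* t) := b :* b :* (t :* t)) refl B t ⟩
  B * B * (t * t)                 ≤⟨ *-monoʳ-≤ (B * B) square ⟩
  B * B * (T * t′)                ≡⟨ solve 3 (λ b t s → b :* b :* (t :* s) := b :* b :* s :* t) refl B T t′ ⟩
  B * B * t′ * T                  ≡⟨ cong (λ x → x * t′ * T) (sym (^-distribˡ-+-* K C C)) ⟩
  K ^ (C + C) * t′ * T            ∎)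
  where
  open ≤-Reasoning
  open +-*-Solver
  A = a ^ C
  B = K ^ C

mass≢0 : ∀ n m → .{{NonZero n}} → NonZero (mass n m)
mass≢0 n m = m*n≢0 (2 ^ n) (n ^ m) {{m^n≢0 2 n}} {{m^n≢0 n m}}

factors≢0 : ∀ {a b} → a * b ≢ 0 → a ≢ 0 × b ≢ 0
factors≢0 {a} {b} ab≢0 = (λ { refl → ab≢0 refl }) , (λ { refl → ab≢0 (*-zeroʳ a) })

module _ {m : ℕ} {Y′ Y : Pattern m} {X : Vec Bool m} where

  cleared : ∀ {x k} → lookup X k ≡ false → lookup (X [ x ]≔ false) k ≡ false
  cleared {x} {k} k∉X with k ≟ᶠ x
  ... | yes refl = lookup∘update k X false
  ... | no k≢x   = trans (lookup∘update′ k≢x X false) k∉X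

  member-distinct : ∀ {x k} → lookup X x ≡ true → lookup X k ≡ false → k ≢ x
  member-distinct x∈X k∉X refl = contradiction (trans (sym x∈X) k∉X) (λ ())

  abundant-delete : ∀ f → (∀ l h → Y l h → Y′ l h) → Abundant Y′ (X [ f ]≔ false) → Abundant Y X
  abundant-delete f incl (C , 1≤C , packing) = C , 1≤C , restricted
    where
    restricted : ∀ n → .{{NonZero n}} → (D : DirectedEdges n) → Packing Y X C D
    restricted n D = record
      { weight  = weight
      ; ≤1      = ≤1
      ; ignores = λ k k∉X → ignores k (cleared k∉X)
      ; hits    = λ z φ w≢0 l h y → hits z φ w≢0 l h (incl l h y)
      ; bound   = bound
      }
      where open Packing (packing n D)

  -- The weight for `Y′` does not read entry `f`, so `lookup φ f` is a fresh sample for `f′`.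
  -- Weights are 0 or 1, so their product is the conjunction of the two events.
  abundant-parallel : ∀ {f f′} → f ≢ f′ → lookup X f ≡ true → lookup X f′ ≡ true →
    (∀ {n} {D : DirectedEdges n} z φ → Hits D Y′ z φ → Hits D Y′ z (φ [ f′ ]≔ lookup φ f) → Hits D Y z φ) →
    Abundant Y′ (X [ f ]≔ false) → Abundant Y X
  abundant-parallel {f} {f′} f≢f′ f∈X f′∈X hit (C , 1≤C , packing) = C + C , ≤-trans 1≤C (m≤m+n C C) , duplicated
    where
    duplicated : ∀ n → .{{NonZero n}} → (D : DirectedEdges n) → Packing Y X (C + C) D
    duplicated n D = record
      { weight  = λ z φ → weight z φ * weight z (φ [ f′ ]≔ lookup φ f)
      ; ≤1      = λ z φ → *-mono-≤ (≤1 z φ) (≤1 z _)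
      ; ignores = λ k k∉X z φ i → cong₂ _*_ (ignores k (cleared k∉X) z φ i)
          (trans (cong (weight z) (trans (cong ((φ [ k ]≔ i) [ f′ ]≔_) (lookup∘update′ (member-distinct f∈X k∉X ∘ sym) φ i))
            ([]≔-commutes φ k f′ (member-distinct f′∈X k∉X))))
            (ignores k (cleared k∉X) z (φ [ f′ ]≔ lookup φ f) i))
      ; hits    = λ z φ w≢0 → hit {D = D} z φ (hits z φ (proj₁ (factors≢0 w≢0))) (hits z _ (proj₂ (factors≢0 {weight z φ} w≢0)))
      ; bound   = bound-square {a = edges D} {2 ^ n * n} {C} {{mass≢0 n m}} bound
          (total-duplicate weight f f′ f≢f′ (ignores f (lookup∘update f X false)))
      }
      where open Packing (packing n D)

  abundant-pendant : ∀ {x} → lookup X x ≡ true →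
    (∀ {n} {D : DirectedEdges n} z φ → Hits D Y′ (flip (lookup φ x) z) φ → Hits D Y z φ) →
    Abundant Y′ (X [ x ]≔ false) → Abundant Y X
  abundant-pendant {x} x∈X hit (C , 1≤C , packing) = C , 1≤C , shifted
    where
    shifted : ∀ n → .{{NonZero n}} → (D : DirectedEdges n) → Packing Y X C D
    shifted n D = record
      { weight  = λ z φ → weight (flip (lookup φ x) z) φ
      ; ≤1      = λ z φ → ≤1 _ φ
      ; ignores = λ k k∉X z φ i → trans (cong (λ j → weight (flip j z) (φ [ k ]≔ i)) (lookup∘update′ (member-distinct x∈X k∉X ∘ sym) φ i))
          (ignores k (cleared k∉X) (flip (lookup φ x) z) φ i)
      ; hits    = λ z φ w≢0 → hit {D = D} z φ (hits _ φ w≢0)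
      ; bound   = subst (λ t → edges D ^ C * mass n m ≤ (2 ^ n * n) ^ C * t) (sym (total-flip weight x)) bound
      }
      where open Packing (packing n D)

  -- Dual to abundant-parallel: based at the top vertex z + φ x + φ y, the two factors are again
  -- independent copies.
  abundant-series : ∀ {x y} → x ≢ y → lookup X x ≡ true → lookup X y ≡ true →
    (∀ {n} {D : DirectedEdges n} z φ → Hits D Y′ (flip (lookup φ x) z) φ →
      Hits D Y′ (flip (lookup φ y) z) (φ [ y ]≔ lookup φ x) → Hits D Y z φ) →
    Abundant Y′ (X [ x ]≔ false) → Abundant Y X
  abundant-series {x} {y} x≢y x∈X y∈X hit (C , 1≤C , packing) = C + C , ≤-trans 1≤C (m≤m+n C C) , doubled
    where
    doubled : ∀ n → .{{NonZero n}} → (D : DirectedEdges n) → Packing Y X (C + C) D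
    doubled n D = record
      { weight  = w
      ; ≤1      = λ z φ → *-mono-≤ (≤1 _ φ) (≤1 _ _)
      ; ignores = λ k k∉X z φ i → cong₂ _*_
          (trans (cong (λ j → weight (flip j z) (φ [ k ]≔ i)) (same-x k∉X φ i)) (ignores k (cleared k∉X) _ φ i))
          (trans (cong₂ (λ j j′ → weight (flip j z) ((φ [ k ]≔ i) [ y ]≔ j′)) (lookup∘update′ (member-distinct y∈X k∉X ∘ sym) φ i) (same-x k∉X φ i))
            (trans (cong (weight _) ([]≔-commutes φ k y (member-distinct y∈X k∉X))) (ignores k (cleared k∉X) _ _ i)))
      ; hits    = λ z φ w≢0 → hit {D = D} z φ (hits _ φ (proj₁ (factors≢0 w≢0))) (hits _ _ (proj₂ (factors≢0 {weight _ φ} w≢0)))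
      ; bound   = bound-square {a = edges D} {2 ^ n * n} {C} {{mass≢0 n m}} bound square
      }
      where
      open Packing (packing n D)
      same-x : ∀ {k} → lookup X k ≡ false → ∀ (φ : Vec (Fin n) m) i → lookup (φ [ k ]≔ i) x ≡ lookup φ x
      same-x k∉X φ i = lookup∘update′ (member-distinct x∈X k∉X ∘ sym) φ i
      w top : Weight n m
      w z φ   = weight (flip (lookup φ x) z) φ * weight (flip (lookup φ y) z) (φ [ y ]≔ lookup φ x)
      top z φ = weight (flip (lookup φ y) z) φ
      top-ignores : ∀ z φ i → top z (φ [ x ]≔ i) ≡ top z φ
      top-ignores z φ i = trans (cong (λ j → weight (flip j z) (φ [ x ]≔ i)) (lookup∘update′ (x≢y ∘ sym) φ i))
        (ignores x (lookup∘update x X false) _ φ i)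
      w-top : ∀ z φ → w (flip (lookup φ x) (flip (lookup φ y) z)) φ ≡ top z φ * top z (φ [ y ]≔ lookup φ x)
      w-top z φ = cong₂ _*_ (cong (λ z → weight z φ) (flip-involutive (lookup φ x) _))
        (cong (λ z → weight z (φ [ y ]≔ lookup φ x)) (begin
          flip (lookup φ y) (flip (lookup φ x) (flip (lookup φ y) z)) ≡⟨ cong (flip (lookup φ y)) (flip-comm (lookup φ x) (lookup φ y) z) ⟩
          flip (lookup φ y) (flip (lookup φ y) (flip (lookup φ x) z)) ≡⟨ flip-involutive (lookup φ y) _ ⟩
          flip (lookup φ x) z                                         ≡⟨ cong (λ j → flip j z) (sym (lookup∘update y φ (lookup φ x))) ⟩
          flip (lookup (φ [ y ]≔ lookup φ x) y) z                     ∎))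
        where open ≡-Reasoning
      square : total weight * total weight ≤ mass n m * total w
      square = begin
        total weight * total weight                                        ≡⟨ cong (λ t → t * t) (sym (total-flip weight y)) ⟩
        total top * total top                                              ≤⟨ total-duplicate top x y x≢y top-ignores ⟩
        mass n m * total (λ z φ → top z φ * top z (φ [ y ]≔ lookup φ x))   ≡⟨ cong (mass n m *_) (sym (total-cong w-top)) ⟩
        mass n m * total (λ z φ → w (flip (lookup φ x) (flip (lookup φ y) z)) φ)
          ≡⟨ cong (mass n m *_) (trans (total-flip (λ z φ → w (flip (lookup φ x) z) φ) y) (total-flip w x)) ⟩
        mass n m * total w                                                 ∎
        where open ≤-Reasoning

-- Series-parallel reduction

_⊕_ : ∀ {m} → Vec Bool m → Fin m → Fin m → Set
(l ⊕ e) h = lookup l h ≡ true ⊎ h ≡ e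

-- Y(G,e) with E(G) as coordinates (e itself is never used, as e ∉ X) and restricted to edges in X.
-- Deletion only shrinks X, so that g stays connected and keeps its supply of small vertices.
record TreePair {n m} (g : Ends n m) (e : Fin m) (X l : Vec Bool m) (f : Fin m) : Set where
  constructor treePair
  field
    l⊆X : ∀ h → lookup l h ≡ true → lookup X h ≡ true
    new∈X : lookup X f ≡ true
    new∉l : lookup l f ≡ false
    l⊕e : Tree g (l ⊕ e)
    l⊕f : Tree g (l ⊕ f)

true≢false : ∀ {b} → b ≡ true → b ≢ false
true≢false refl ()

≢true⇒false : ∀ {b} → b ≢ true → b ≡ false
≢true⇒false {true}  b≢true = contradiction refl b≢true
≢true⇒false {false} _      = refl

count-clear : ∀ {m} (X : Vec Bool m) f → lookup X f ≡ true → suc (count (X [ f ]≔ false)) ≡ count X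
count-clear (true ∷ X)  zero    _   = refl
count-clear (true ∷ X)  (suc f) f∈X = cong suc (count-clear X f f∈X)
count-clear (false ∷ X) (suc f) f∈X = count-clear X f f∈X

module _ {m : ℕ} (l : Vec Bool m) {x : Fin m} where

  lookup-clear⁻ : ∀ {h} → lookup (l [ x ]≔ false) h ≡ true → lookup l h ≡ true × h ≢ x
  lookup-clear⁻ {h} on with h ≟ᶠ x
  ... | yes refl = contradiction (lookup∘update h l false) (true≢false on)
  ... | no h≢x   = trans (sym (lookup∘update′ h≢x l false)) on , h≢x

  lookup-clear⁺ : ∀ {h b} → h ≢ x → lookup l h ≡ b → lookup (l [ x ]≔ false) h ≡ b
  lookup-clear⁺ h≢x eq = trans (lookup∘update′ h≢x l false) eq

  lookup-clear-false : ∀ {h} → lookup l h ≡ false → lookup (l [ x ]≔ false) h ≡ false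
  lookup-clear-false {h} off with h ≟ᶠ x
  ... | yes refl = lookup∘update h l false
  ... | no h≢x   = lookup-clear⁺ h≢x off

module _ {n m : ℕ} {g : Ends n m} where

  tree-clear : ∀ {l : Vec Bool m} {e x} → e ≢ x → Tree g (Without (graph g) (l ⊕ e) x) → Tree g ((l [ x ]≔ false) ⊕ e)
  tree-clear {l} {e} {x} e≢x = tree-cong to from
    where
    to : ∀ h → Without (graph g) (l ⊕ e) x h → ((l [ x ]≔ false) ⊕ e) h
    to h (inj₁ on , h≢x)  = inj₁ (lookup-clear⁺ l h≢x on)
    to h (inj₂ h≡e , h≢x) = inj₂ h≡e
    from : ∀ h → ((l [ x ]≔ false) ⊕ e) h → Without (graph g) (l ⊕ e) x h
    from h (inj₁ on)   = inj₁ (proj₁ (lookup-clear⁻ l on)) , proj₂ (lookup-clear⁻ l on)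
    from h (inj₂ refl) = inj₂ refl , e≢x

  -- Both sets equal `l`. This is how `y` takes over as the added edge once `x` has been contracted.
  tree-move : ∀ {l : Vec Bool m} {x y} → lookup l x ≡ false → lookup l y ≡ true →
    Tree g (Without (graph g) (l ⊕ x) x) → Tree g ((l [ y ]≔ false) ⊕ y)
  tree-move {l} {x} {y} x∉l y∈l = tree-cong to from
    where
    to : ∀ h → Without (graph g) (l ⊕ x) x h → ((l [ y ]≔ false) ⊕ y) h
    to h (inj₂ h≡x , h≢x) = contradiction h≡x h≢x
    to h (inj₁ on , _) with h ≟ᶠ y
    ... | yes h≡y = inj₂ h≡y
    ... | no h≢y  = inj₁ (lookup-clear⁺ l h≢y on)
    from : ∀ h → ((l [ y ]≔ false) ⊕ y) h → Without (graph g) (l ⊕ x) x h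
    from h (inj₁ on)   = inj₁ (proj₁ (lookup-clear⁻ l on)) , λ { refl → true≢false (proj₁ (lookup-clear⁻ l on)) x∉l }
    from h (inj₂ refl) = inj₁ y∈l , λ { refl → true≢false y∈l x∉l }

-- Deleting loops and parallel edges

module Deletion {n m : ℕ} (g : Ends n m) (e : Fin m) (X : Vec Bool m) (e∉X : lookup X e ≡ false) where

  e≢ : ∀ {f} → lookup X f ≡ true → e ≢ f
  e≢ f∈X refl = true≢false f∈X e∉X

  treePair-delete : ∀ {f l h} → lookup l f ≡ false → h ≢ f → TreePair g e X l h → TreePair g e (X [ f ]≔ false) l h
  treePair-delete f∉l h≢f (treePair l⊆X h∈X h∉l l⊕e l⊕h) = treePair
    (λ k k∈l → lookup-clear⁺ X (λ { refl → true≢false k∈l f∉l }) (l⊆X k k∈l)) (lookup-clear⁺ X h≢f h∈X) h∉l l⊕e l⊕h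

  abundant-loop : ∀ {f} → lookup X f ≡ true → src g f ≡ tgt g f →
    Abundant (TreePair g e (X [ f ]≔ false)) (X [ f ]≔ false) → Abundant (TreePair g e X) X
  abundant-loop {f} f∈X loop = abundant-delete f λ l h p →
    treePair-delete (≢true⇒false (λ f∈l → tree-no-loop (TreePair.l⊕e p) (inj₁ f∈l) loop)) (λ { refl → tree-no-loop (TreePair.l⊕f p) (inj₂ refl) loop }) p

  module _ {f f′} (f≢f′ : f ≢ f′) (f∈X : lookup X f ≡ true) (f′∈X : lookup X f′ ≡ true) (par : Parallel g f f′) where

    private
      X′ = X [ f ]≔ false

    module _ {l h} (p : TreePair g e X l h) where
      open TreePair p

      -- A tree contains no two parallel edges, so `f′` is neither in `l` nor equal to `h`, and it
      -- can replace `f` in both trees of the pair.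
      swapped-set : lookup l f ≡ true → TreePair g e X′ ((l [ f ]≔ false) [ f′ ]≔ true) h × h ≢ f′ × lookup l f′ ≡ false
      swapped-set f∈l = treePair l′⊆X′ (lookup-clear⁺ X h≢f new∈X) h∉l′ (exchange l⊕e (e≢ f∈X)) (exchange l⊕f h≢f) , h≢f′ , f′∉l
        where
        l′ = (l [ f ]≔ false) [ f′ ]≔ true
        f′∉l : lookup l f′ ≡ false
        f′∉l = ≢true⇒false (λ f′∈l → tree-no-parallel l⊕e f≢f′ par (inj₁ f∈l) (inj₁ f′∈l))
        h≢f′ : h ≢ f′
        h≢f′ refl = tree-no-parallel l⊕f f≢f′ par (inj₁ f∈l) (inj₂ refl)
        h≢f : h ≢ f
        h≢f refl = true≢false f∈l new∉l
        l′-old : ∀ {k b} → k ≢ f′ → k ≢ f → lookup l k ≡ b → lookup l′ k ≡ b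
        l′-old k≢f′ k≢f eq = trans (lookup∘update′ k≢f′ (l [ f ]≔ false) true) (lookup-clear⁺ l k≢f eq)
        l′-inv : ∀ {k} → lookup l′ k ≡ true → k ≡ f′ ⊎ (lookup l k ≡ true × k ≢ f)
        l′-inv {k} on with k ≟ᶠ f′
        ... | yes k≡f′ = inj₁ k≡f′
        ... | no k≢f′  = inj₂ (lookup-clear⁻ l (trans (sym (lookup∘update′ k≢f′ (l [ f ]≔ false) true)) on))
        l′⊆X′ : ∀ k → lookup l′ k ≡ true → lookup X′ k ≡ true
        l′⊆X′ k on with l′-inv {k} on
        ... | inj₁ refl          = lookup-clear⁺ X (f≢f′ ∘ sym) f′∈X
        ... | inj₂ (k∈l , k≢f)   = lookup-clear⁺ X k≢f (l⊆X k k∈l)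
        h∉l′ : lookup l′ h ≡ false
        h∉l′ = l′-old h≢f′ h≢f new∉l
        exchange : ∀ {k} → Tree g (l ⊕ k) → k ≢ f → Tree g (l′ ⊕ k)
        exchange {k} tree k≢f = tree-exchange tree (inj₁ f∈l) f≢f′ par (inj₁ (lookup∘update f′ (l [ f ]≔ false) true)) to from
          where
          to : ∀ i → (l ⊕ k) i → i ≢ f → (l′ ⊕ k) i
          to i (inj₂ i≡k) _ = inj₂ i≡k
          to i (inj₁ i∈l) i≢f = inj₁ (l′-old (λ { refl → true≢false i∈l f′∉l }) i≢f i∈l)
          from : ∀ i → (l′ ⊕ k) i → i ≡ f′ ⊎ ((l ⊕ k) i × i ≢ f)
          from i (inj₂ refl) = inj₂ (inj₂ refl , k≢f)
          from i (inj₁ on) with l′-inv {i} on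
          ... | inj₁ i≡f′         = inj₁ i≡f′
          ... | inj₂ (i∈l , i≢f)  = inj₂ (inj₁ i∈l , i≢f)

      swapped-edge : h ≡ f → TreePair g e X′ l f′ × lookup l f′ ≡ false
      swapped-edge refl = treePair (λ k k∈l → lookup-clear⁺ X (λ { refl → true≢false k∈l new∉l }) (l⊆X k k∈l))
          (lookup-clear⁺ X (f≢f′ ∘ sym) f′∈X) f′∉l l⊕e
          (tree-exchange l⊕f (inj₂ refl) f≢f′ par (inj₂ refl) to from) , f′∉l
        where
        f′∉l : lookup l f′ ≡ false
        f′∉l = ≢true⇒false (λ f′∈l → tree-no-parallel l⊕f f≢f′ par (inj₂ refl) (inj₁ f′∈l))
        to : ∀ i → (l ⊕ f) i → i ≢ f → (l ⊕ f′) i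
        to i (inj₁ i∈l) _   = inj₁ i∈l
        to i (inj₂ i≡f) i≢f = contradiction i≡f i≢f
        from : ∀ i → (l ⊕ f′) i → i ≡ f′ ⊎ ((l ⊕ f) i × i ≢ f)
        from i (inj₁ i∈l)  = inj₂ (inj₁ i∈l , λ { refl → true≢false i∈l new∉l })
        from i (inj₂ i≡f′) = inj₁ i≡f′

    -- A pair that involves `f`, in `l` or as `h`, is turned into one that involves `f′` instead.
    -- Giving `f′` the value `lookup φ f` makes the new pair land on the same edge of the cube as
    -- the old one.
    parallel-hits : ∀ {k} {D : DirectedEdges k} z φ → Hits D (TreePair g e X′) z φ →
      Hits D (TreePair g e X′) z (φ [ f′ ]≔ lookup φ f) → Hits D (TreePair g e X) z φ
    parallel-hits {k} {D} z φ hit hit′ l h p = by-cases (lookup l f ≟ᵇ true) (h ≟ᶠ f)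
      where
      φ′ = φ [ f′ ]≔ lookup φ f
      by-cases : Dec (lookup l f ≡ true) → Dec (h ≡ f) → D (act z φ l) (lookup φ h) ≡ true
      by-cases (no f∉l) (no h≢f)   = hit l h (treePair-delete (≢true⇒false f∉l) h≢f p)
      by-cases (no _)   (yes refl) with swapped-edge p refl
      ... | p′ , f′∉l = subst₂ (λ w i → D w i ≡ true) (act-ignore z φ l f′ (lookup φ f) f′∉l) (lookup∘update f′ φ (lookup φ f)) (hit′ l f′ p′)
      by-cases (yes f∈l) _ with swapped-set p f∈l
      ... | p′ , h≢f′ , f′∉l = subst₂ (λ w i → D w i ≡ true) same (lookup∘update′ h≢f′ φ (lookup φ f)) (hit′ _ h p′)
        where
        l₀ = l [ f ]≔ false
        f′∉l₀ : lookup l₀ f′ ≡ false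
        f′∉l₀ = lookup-clear-false l f′∉l
        same : act z φ′ (l₀ [ f′ ]≔ true) ≡ act z φ l
        same = begin
          act z φ′ (l₀ [ f′ ]≔ true)            ≡⟨ act-insert z φ′ l₀ f′ f′∉l₀ ⟩
          flip (lookup φ′ f′) (act z φ′ l₀)     ≡⟨ cong₂ flip (lookup∘update f′ φ (lookup φ f)) (act-ignore z φ l₀ f′ (lookup φ f) f′∉l₀) ⟩
          flip (lookup φ f) (act z φ l₀)        ≡⟨ sym (act-flip (lookup φ f) z φ l₀) ⟩
          act (flip (lookup φ f) z) φ l₀        ≡⟨ act-remove z φ l f f∈l ⟩
          act z φ l                             ∎
          where open ≡-Reasoning

-- Contracting an edge at a vertex with at most two edges

module Contraction {n m : ℕ} (g : Ends (suc n) m) (e : Fin m) (X : Vec Bool m) (e∉X : lookup X e ≡ false)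
  (v u : Fin (suc n)) (v≢u : v ≢ u) (v≢s : v ≢ src g e) (v≢t : v ≢ tgt g e)
  (x : Fin m) (x∈X : lookup X x ≡ true) (xj : Joins (graph g) x v u) where

  open Merge v u v≢u
  open Deletion g e X e∉X using (e≢)

  private
    X′ = X [ x ]≔ false

  -- The edge `e` is not at `v`, so the tree `l ⊕ e` can reach `v` only by an edge of `l`.
  touches : ∀ {l h} → TreePair g e X l h → ∃ λ f → lookup l f ≡ true × Incident g v f
  touches p with tree-incident (TreePair.l⊕e p) v≢s
  ... | f , inj₁ f∈l , inc         = f , f∈l , inc
  ... | f , inj₂ refl , inj₁ s≡v   = contradiction (sym s≡v) v≢s
  ... | f , inj₂ refl , inj₂ t≡v   = contradiction (sym t≡v) v≢t

  contract-in : ∀ {l h} → TreePair g e X l h → lookup l x ≡ true → TreePair (image merge g) e X′ (l [ x ]≔ false) h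
  contract-in {l} {h} p x∈l = treePair
    (λ k on → lookup-clear⁺ X (proj₂ (lookup-clear⁻ l on)) (l⊆X k (proj₁ (lookup-clear⁻ l on))))
    (lookup-clear⁺ X h≢x new∈X) (lookup-clear-false l new∉l)
    (tree-clear {g = image merge g} {l} (e≢ x∈X) (tree-contract v≢u xj l⊕e (inj₁ x∈l)))
    (tree-clear {g = image merge g} {l} h≢x (tree-contract v≢u xj l⊕f (inj₁ x∈l)))
    where
    open TreePair p
    h≢x : h ≢ x
    h≢x refl = true≢false x∈l new∉l

  pendant-hits : (∀ f → lookup X f ≡ true → Incident g v f → f ≡ x) → ∀ {k} {D : DirectedEdges k} z φ →
    Hits D (TreePair (image merge g) e X′) (flip (lookup φ x) z) φ → Hits D (TreePair g e X) z φ
  pendant-hits only {k} {D} z φ hit l h p with touches p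
  ... | f , f∈l , inc with only f (TreePair.l⊆X p f f∈l) inc
  ...   | refl = subst (λ w → D w (lookup φ h) ≡ true) (act-remove z φ l x f∈l) (hit (l [ x ]≔ false) h (contract-in p f∈l))

  -- If `x` is in `l`, it is contracted and `z` moves by `lookup φ x`. Otherwise `y` is in `l` with
  -- `v` as a leaf, so `y` is dropped and `z` moves by `lookup φ y`. These are the two factors of
  -- the series weight.
  module Series (y : Fin m) (x≢y : x ≢ y) (y∈X : lookup X y ≡ true) (w : Fin (suc n)) (v≢w : v ≢ w)
    (yj : Joins (graph g) y v w) (only : ∀ f → lookup X f ≡ true → Incident g v f → f ≡ x ⊎ f ≡ y) where

    module _ {l h} (p : TreePair g e X l h) (x∉l : lookup l x ≡ false) where
      open TreePair p

      y∈l : lookup l y ≡ true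
      y∈l with touches p
      ... | f , f∈l , inc with only f (l⊆X f f∈l) inc
      ...   | inj₁ refl = contradiction x∉l (true≢false f∈l)
      ...   | inj₂ refl = f∈l

      h≢y : h ≢ y
      h≢y refl = true≢false y∈l new∉l

      l′⊆X′ : ∀ k → lookup (l [ y ]≔ false) k ≡ true → lookup X′ k ≡ true
      l′⊆X′ k on = lookup-clear⁺ X (λ { refl → true≢false (proj₁ (lookup-clear⁻ l on)) x∉l }) (l⊆X k (proj₁ (lookup-clear⁻ l on)))

      -- The hypotheses keep `f` away from `v`, so `y` is the only tree edge there; `v` is a leaf
      -- and may be merged into `u` instead of `w`.
      leaf-tree : ∀ {f} → f ≢ x → f ≢ y → (Incident g v f → f ≡ x ⊎ f ≡ y) → Tree g (l ⊕ f) → Tree (image merge g) ((l [ y ]≔ false) ⊕ f)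
      leaf-tree {f} f≢x f≢y inc-f tree = tree-clear {g = image merge g} {l} f≢y (tree-contract-leaf v≢u v≢w yj tree (inj₁ y∈l) leaf)
        where
        leaf : ∀ k → (l ⊕ f) k → Incident g v k → k ≡ y
        leaf k (inj₁ k∈l) inc with only k (l⊆X k k∈l) inc
        ... | inj₁ refl = contradiction x∉l (true≢false k∈l)
        ... | inj₂ k≡y  = k≡y
        leaf k (inj₂ refl) inc with inc-f inc
        ... | inj₁ k≡x = contradiction k≡x f≢x
        ... | inj₂ k≡y = k≡y

      l′⊕e : Tree (image merge g) ((l [ y ]≔ false) ⊕ e)
      l′⊕e = leaf-tree (e≢ x∈X) (e≢ y∈X) (λ { (inj₁ s≡v) → contradiction (sym s≡v) v≢s ; (inj₂ t≡v) → contradiction (sym t≡v) v≢t }) l⊕e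

      contract-out : h ≢ x → TreePair (image merge g) e X′ (l [ y ]≔ false) h
      contract-out h≢x = treePair l′⊆X′ (lookup-clear⁺ X h≢x new∈X) (lookup-clear-false l new∉l) l′⊕e (leaf-tree h≢x h≢y (only h new∈X) l⊕f)

      -- Contracting `x` in `l ⊕ x` leaves `l`, in which `y` now counts as the added edge. The
      -- direction to be hit is still that of `x`, which is why `y` receives the value `lookup φ x`.
      contract-edge : h ≡ x → TreePair (image merge g) e X′ (l [ y ]≔ false) y
      contract-edge refl = treePair l′⊆X′ (lookup-clear⁺ X (x≢y ∘ sym) y∈X) (lookup∘update y l false) l′⊕e
        (tree-move {g = image merge g} {l} x∉l y∈l (tree-contract v≢u xj l⊕f (inj₂ refl)))

    series-hits : ∀ {k} {D : DirectedEdges k} z φ → Hits D (TreePair (image merge g) e X′) (flip (lookup φ x) z) φ →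
      Hits D (TreePair (image merge g) e X′) (flip (lookup φ y) z) (φ [ y ]≔ lookup φ x) → Hits D (TreePair g e X) z φ
    series-hits {k} {D} z φ hit hit′ l h p = by-cases (lookup l x ≟ᵇ true)
      where
      φ′ = φ [ y ]≔ lookup φ x
      l′ = l [ y ]≔ false
      same : lookup l x ≡ false → act (flip (lookup φ y) z) φ′ l′ ≡ act z φ l
      same x∉l = trans (act-ignore (flip (lookup φ y) z) φ l′ y (lookup φ x) (lookup∘update y l false)) (act-remove z φ l y (y∈l p x∉l))
      by-cases : Dec (lookup l x ≡ true) → D (act z φ l) (lookup φ h) ≡ true
      by-cases (yes x∈l) = subst (λ w → D w (lookup φ h) ≡ true) (act-remove z φ l x x∈l) (hit (l [ x ]≔ false) h (contract-in p x∈l))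
      by-cases (no ¬x∈l) with ≢true⇒false ¬x∈l | h ≟ᶠ x
      ... | x∉l | no h≢x = subst₂ (λ w i → D w i ≡ true) (same x∉l) (lookup∘update′ (h≢y p x∉l) φ (lookup φ x)) (hit′ l′ h (contract-out p x∉l h≢x))
      ... | x∉l | yes h≡x = subst₂ (λ w i → D w i ≡ true) (same x∉l) (trans (lookup∘update y φ (lookup φ x)) (cong (lookup φ) (sym h≡x))) (hit′ l′ y (contract-edge p x∉l h≡x))

-- The induction over reductions

AbundantTrees : ℕ → Set
AbundantTrees n = ∀ {m} (g : Ends n m) e → Connected (graph g) → ¬ HasK4Minor (graph g) → src g e ≢ tgt g e →
  ∀ X → lookup X e ≡ false → Abundant (TreePair g e X) X

module Step {n : ℕ} (ih : AbundantTrees n) {m} (g : Ends (suc n) m) (e : Fin m) (conn : Connected (graph g))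
  (noK4 : ¬ HasK4Minor (graph g)) (s≢t : src g e ≢ tgt g e) where

  s t : Fin (suc n)
  s = src g e
  t = tgt g e

  module Reduced (X : Vec Bool m) (e∉X : lookup X e ≡ false)
    (no-loop : ∀ f → lookup X f ≡ true → src g f ≢ tgt g f)
    (no-parallel : ∀ f f′ → f ≢ f′ → lookup X f ≡ true → lookup X f′ ≡ true → ¬ Parallel g f f′) where

    joins-distinct : ∀ {f x y} → lookup X f ≡ true → Joins (graph g) f x y → x ≢ y
    joins-distinct {f} f∈X j refl with joins-cases {g = g} {f} j
    ... | inj₁ (a , b) = no-loop f f∈X (trans a (sym b))
    ... | inj₂ (a , b) = no-loop f f∈X (trans a (sym b))

    no-double : ∀ {f f′ x y} → f ≢ f′ → lookup X f ≡ true → lookup X f′ ≡ true → Joins (graph g) f x y → ¬ Joins (graph g) f′ x y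
    no-double {f} {f′} f≢f′ f∈X f′∈X j j′ = no-parallel f f′ f≢f′ f∈X f′∈X (joins-parallel {g = g} {f} {f′} j j′)

    -- Every edge of `X` joins `s` and `t`, so there is at most one. It must be `h`, and then
    -- nothing remains for `l`.
    two-vertices : (∀ w → w ≡ s ⊎ w ≡ t) → Abundant (TreePair g e X) X
    two-vertices all with any? (λ k → lookup X k ≟ᵇ true)
    ... | no none       = abundant-empty (λ l h p → none (h , TreePair.new∈X p))
    ... | yes (k , k∈X) = abundant-single k k∈X only-k
      where
      joins-st : ∀ f → lookup X f ≡ true → Joins (graph g) f s t
      joins-st f f∈X with all (src g f) | all (tgt g f)
      ... | inj₁ a | inj₂ b = inj₁ (cong₂ _,_ a b)
      ... | inj₂ a | inj₁ b = inj₂ (cong₂ _,_ a b)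
      ... | inj₁ a | inj₁ b = contradiction (trans a (sym b)) (no-loop f f∈X)
      ... | inj₂ a | inj₂ b = contradiction (trans a (sym b)) (no-loop f f∈X)
      unique : ∀ {f} → lookup X f ≡ true → k ≡ f
      unique {f} f∈X with k ≟ᶠ f
      ... | yes k≡f = k≡f
      ... | no k≢f  = contradiction (joins-st f f∈X) (no-double k≢f k∈X f∈X (joins-st k k∈X))
      only-k : ∀ l h → TreePair g e X l h → h ≡ k × (∀ i → lookup l i ≡ false)
      only-k l h (treePair l⊆X h∈X h∉l _ _) = sym (unique h∈X) , λ i → ≢true⇒false (λ i∈l →
        true≢false i∈l (subst (λ j → lookup l j ≡ false) (trans (sym (unique h∈X)) (unique (l⊆X i i∈l))) h∉l))

    module At (v : Fin (suc n)) (v≢s : v ≢ s) (v≢t : v ≢ t) (small : Small g v) where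

      p q : Fin (suc n)
      p = proj₁ small
      q = proj₁ (proj₂ small)

      far-end : ∀ {f w} → lookup X f ≡ true → Joins (graph g) f v w → w ≡ p ⊎ w ≡ q
      far-end {f} f∈X j = drop-first (joins-distinct f∈X j ∘ sym) (proj₂ (proj₂ small) _ (f , j))

      -- Without loops and parallel edges in `X`, three edges at `v` would have three distinct far
      -- ends, while smallness of `v` offers two.
      at-most-two : ∀ {f₁ f₂ f₃ w₁ w₂ w₃} → f₁ ≢ f₂ → f₁ ≢ f₃ → f₂ ≢ f₃ →
        lookup X f₁ ≡ true → lookup X f₂ ≡ true → lookup X f₃ ≡ true →
        Joins (graph g) f₁ v w₁ → Joins (graph g) f₂ v w₂ → ¬ Joins (graph g) f₃ v w₃
      at-most-two d₁₂ d₁₃ d₂₃ x₁ x₂ x₃ j₁ j₂ j₃ = three-in-two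
        (λ { refl → no-double d₁₂ x₁ x₂ j₁ j₂ }) (λ { refl → no-double d₁₃ x₁ x₃ j₁ j₃ }) (λ { refl → no-double d₂₃ x₂ x₃ j₂ j₃ })
        (far-end x₁ j₁) (far-end x₂ j₂) (far-end x₃ j₃)

      incident? : ∀ f → Dec (lookup X f ≡ true × Incident g v f)
      incident? f = (lookup X f ≟ᵇ true) ×-dec ((src g f ≟ᶠ v) ⊎-dec (tgt g f ≟ᶠ v))

      isolated : (∀ f → lookup X f ≡ true → ¬ Incident g v f) → Abundant (TreePair g e X) X
      isolated none = abundant-empty λ l h p → absurd p (tree-incident (TreePair.l⊕e p) v≢s)
        where
        absurd : ∀ {l h} → TreePair g e X l h → (∃ λ f → (l ⊕ e) f × Incident g v f) → ⊥
        absurd p (f , inj₁ f∈l , inc)         = none f (TreePair.l⊆X p f f∈l) inc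
        absurd p (f , inj₂ refl , inj₁ s≡v)   = v≢s (sym s≡v)
        absurd p (f , inj₂ refl , inj₂ t≡v)   = v≢t (sym t≡v)

      contract : ∀ x u → lookup X x ≡ true → Joins (graph g) x v u → Abundant (TreePair g e X) X
      contract x u x∈X xj = by-second (any? (λ y → ¬? (x ≟ᶠ y) ×-dec incident? y))
        where
        v≢u : v ≢ u
        v≢u = joins-distinct x∈X xj
        open Merge v u v≢u
        open Contraction g e X e∉X v u v≢u v≢s v≢t x x∈X xj
        contracted : Abundant (TreePair (image merge g) e (X [ x ]≔ false)) (X [ x ]≔ false)
        contracted = ih (image merge g) e (connected-image merge g (λ y → punchIn v y , merge-punchIn y) conn)
          (noK4 ∘ k4-lift {g = g} x xj) (s≢t ∘ merge-cancel (v≢s ∘ sym) (v≢t ∘ sym)) (X [ x ]≔ false) (lookup-clear-false X e∉X)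
        by-second : Dec (∃ λ y → x ≢ y × lookup X y ≡ true × Incident g v y) → Abundant (TreePair g e X) X
        by-second (no none) = abundant-pendant x∈X (λ {_} {D} → pendant-hits only {D = D}) contracted
          where
          only : ∀ f → lookup X f ≡ true → Incident g v f → f ≡ x
          only f f∈X inc with x ≟ᶠ f
          ... | yes x≡f = sym x≡f
          ... | no x≢f  = contradiction (f , x≢f , f∈X , inc) none
        by-second (yes (y , x≢y , y∈X , inc)) with incident-joins {g = g} {f = y} inc
        ... | w , yj = abundant-series x≢y x∈X y∈X (λ {_} {D} → Series.series-hits y x≢y y∈X w (joins-distinct y∈X yj) yj only {D = D}) contracted
          where
          only : ∀ f → lookup X f ≡ true → Incident g v f → f ≡ x ⊎ f ≡ y
          only f f∈X inc with f ≟ᶠ x | f ≟ᶠ y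
          ... | yes f≡x | _       = inj₁ f≡x
          ... | no _    | yes f≡y = inj₂ f≡y
          ... | no f≢x  | no f≢y  = ⊥-elim (at-most-two x≢y (f≢x ∘ sym) (f≢y ∘ sym) x∈X y∈X f∈X xj yj (proj₂ (incident-joins {g = g} {f = f} inc)))

      eliminate : Abundant (TreePair g e X) X
      eliminate with any? incident?
      ... | no none = isolated (λ f f∈X inc → none (f , f∈X , inc))
      ... | yes (x , x∈X , inc) = contract x _ x∈X (proj₂ (incident-joins {g = g} {f = x} inc))

    reduced : Abundant (TreePair g e X) X
    reduced with any? (λ w → ¬? (w ≟ᶠ s) ×-dec ¬? (w ≟ᶠ t))
    ... | yes (c , c≢s , c≢t) with small-vertex (suc n) g conn noK4 s t s≢t (e , inj₁ refl) c c≢s c≢t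
    ...   | v , v≢s , v≢t , small = At.eliminate v v≢s v≢t small
    reduced | no none = two-vertices all
      where
      all : ∀ w → w ≡ s ⊎ w ≡ t
      all w with w ≟ᶠ s | w ≟ᶠ t
      ... | yes w≡s | _       = inj₁ w≡s
      ... | no _    | yes w≡t = inj₂ w≡t
      ... | no w≢s  | no w≢t  = contradiction (w , w≢s , w≢t) none

  parallel? : ∀ f f′ → Dec (Parallel g f f′)
  parallel? f f′ = joins? g f′ (src g f) (tgt g f)

  -- Inner induction on the size of `X`, within the induction on vertices: deletions shrink `X`
  -- until it is simple, and a contraction then hands over to the outer hypothesis.
  all-sets : ∀ c X → count X ≡ c → lookup X e ≡ false → Abundant (TreePair g e X) X
  all-sets c X size e∉X with any? (λ f → (lookup X f ≟ᵇ true) ×-dec (src g f ≟ᶠ tgt g f))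
  all-sets zero X size e∉X | yes (f , f∈X , _) = contradiction (trans (count-clear X f f∈X) size) (λ ())
  all-sets (suc c) X size e∉X | yes (f , f∈X , loop) = Deletion.abundant-loop g e X e∉X f∈X loop
    (all-sets c (X [ f ]≔ false) (suc-injective (trans (count-clear X f f∈X) size)) (lookup-clear-false X e∉X))
  all-sets c X size e∉X | no loopless
    with any? (λ f → any? (λ f′ → ¬? (f ≟ᶠ f′) ×-dec ((lookup X f ≟ᵇ true) ×-dec ((lookup X f′ ≟ᵇ true) ×-dec parallel? f f′))))
  all-sets zero X size e∉X | no _ | yes (f , _ , _ , f∈X , _) = contradiction (trans (count-clear X f f∈X) size) (λ ())
  all-sets (suc c) X size e∉X | no _ | yes (f , f′ , f≢f′ , f∈X , f′∈X , par) =
    abundant-parallel f≢f′ f∈X f′∈X (λ {_} {D} → Deletion.parallel-hits g e X e∉X f≢f′ f∈X f′∈X par {D = D})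
      (all-sets c (X [ f ]≔ false) (suc-injective (trans (count-clear X f f∈X) size)) (lookup-clear-false X e∉X))
  all-sets c X size e∉X | no loopless | no simple = Reduced.reduced X e∉X
    (λ f f∈X loop → loopless (f , f∈X , loop))
    (λ f f′ f≢f′ f∈X f′∈X par → simple (f , f′ , f≢f′ , f∈X , f′∈X , par))

abundant-trees : ∀ n → AbundantTrees n
abundant-trees zero    g e _ _ _ X _ with src g e
... | ()
abundant-trees (suc n) g e conn noK4 s≢t X e∉X = Step.all-sets (abundant-trees n) g e conn noK4 s≢t (count X) X refl e∉X

-- From homomorphic copies to embeddings

lookup-ext : ∀ {A : Set} {n} {xs ys : Vec A n} → (∀ i → lookup xs i ≡ lookup ys i) → xs ≡ ys
lookup-ext {xs = xs} {ys} eq = trans (sym (tabulate∘lookup xs)) (trans (tabulate-cong eq) (tabulate∘lookup ys))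

xor-cancel : ∀ a b c → (a xor c) ≡ (b xor c) → a ≡ b
xor-cancel true  true  c     _ = refl
xor-cancel false false c     _ = refl
xor-cancel true  false true  ()
xor-cancel true  false false ()
xor-cancel false true  true  ()
xor-cancel false true  false ()

xor-undo : ∀ a c → ((a xor c) xor c) ≡ a
xor-undo true  true  = refl
xor-undo true  false = refl
xor-undo false true  = refl
xor-undo false false = refl

insertAt-update : ∀ {A : Set} {n} (xs : Vec A n) e i (b v : A) →
  insertAt (xs [ i ]≔ v) e b ≡ (insertAt xs e b) [ punchIn e i ]≔ v
insertAt-update (x ∷ xs) zero    i       b v = refl
insertAt-update (x ∷ xs) (suc e) zero    b v = refl
insertAt-update (x ∷ xs) (suc e) (suc i) b v = cong (x ∷_) (insertAt-update xs e i b v)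

count-flip : ∀ {n} (z : Vec Bool n) i → lookup z i ≡ false → count (flip i z) ≡ suc (count z)
count-flip (false ∷ z) zero    _   = refl
count-flip (true ∷ z)  (suc i) off = cong suc (count-flip z i off)
count-flip (false ∷ z) (suc i) off = count-flip z i off

-- All the flipped bits are off in `z` and distinct, so each flip adds one.
count-act : ∀ {n d} z (φ : Vec (Fin n) d) l → Injective φ → (∀ j → lookup z (lookup φ j) ≡ false) →
  count (act z φ l) ≡ count z + count l
count-act z []      []          inj off = sym (+-identityʳ _)
count-act z (i ∷ φ) (false ∷ l) inj off = count-act z φ l (λ j k eq → Fin-suc-injective (inj (suc j) (suc k) eq)) (off ∘ suc)
count-act z (i ∷ φ) (true ∷ l) inj off = trans
  (count-act (flip i z) φ l (λ j k eq → Fin-suc-injective (inj (suc j) (suc k) eq)) still-off)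
  (trans (cong (_+ count l) (count-flip z i (off zero))) (sym (+-suc (count z) (count l))))
  where
  still-off : ∀ j → lookup (flip i z) (lookup φ j) ≡ false
  still-off j = trans (lookup∘updateAt′ (lookup φ j) i (λ eq → contradiction (inj (suc j) zero eq) (λ ())) z) (off (suc j))

count-insertAt : ∀ {d} (l : Vec Bool d) e → count (insertAt l e false) ≡ count l
count-insertAt l           zero    = refl
count-insertAt (true ∷ l)  (suc e) = cong suc (count-insertAt l e)
count-insertAt (false ∷ l) (suc e) = count-insertAt l e

count-full : ∀ d → count (replicate d true) ≡ d
count-full zero    = refl
count-full (suc d) = cong suc (count-full d)

count-empty : ∀ d → count (replicate d false) ≡ 0
count-empty zero    = refl
count-empty (suc d) = count-empty d

module Face {n d : ℕ} (e : Fin (suc d)) (φ : Vec (Fin n) (suc d)) (inj : Injective φ) where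

  κ : Fin d → Fin n
  κ j = lookup φ (punchIn e j)

  κ-injective : ∀ {j k} → κ j ≡ κ k → j ≡ k
  κ-injective eq = punchIn-injective e _ _ (inj _ _ eq)

  place : Vec Bool n → Vec Bool d → Vec Bool n
  place z x = act z φ (insertAt x e false)

  place-on : ∀ z x j → lookup (place z x) (κ j) ≡ (lookup x j xor lookup z (κ j))
  place-on z x j = trans (lookup-act-on z φ inj (insertAt x e false) (punchIn e j))
    (cong (_xor lookup z (κ j)) (insertAt-punchIn x e false j))

  place-off : ∀ z x k → ¬ (∃ λ j → κ j ≡ k) → lookup (place z x) k ≡ lookup z k
  place-off z x k none = lookup-act-off z φ (insertAt x e false) k off
    where
    off : ∀ j → lookup (insertAt x e false) j ≡ true → lookup φ j ≢ k
    off j on φj≡k with e ≟ᶠ j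
    ... | yes refl = true≢false on (insertAt-lookup x e false)
    ... | no e≢j   = none (punchOut e≢j , trans (cong (lookup φ) (punchIn-punchOut e≢j)) φj≡k)

  place-update : ∀ z x i → lookup x i ≡ false → place z (x [ i ]≔ true) ≡ flip (κ i) (place z x)
  place-update z x i off = trans (cong (act z φ) (insertAt-update x e i false true))
    (act-insert z φ (insertAt x e false) (punchIn e i) (trans (insertAt-punchIn x e false i) off))

  -- The indicator vector of the range of `κ`, obtained as the top vertex of the copy based at 0;
  -- its size then follows from `count-act`.
  free : Vec Bool n
  free = place (replicate n false) (replicate d true)

  free-count : count free ≡ d
  free-count = begin
    count free                                                             ≡⟨ count-act (replicate n false) φ _ inj (λ j → lookup-replicate (lookup φ j) false) ⟩
    count (replicate n false) + count (insertAt (replicate d true) e false) ≡⟨ cong₂ _+_ (count-empty n) (trans (count-insertAt (replicate d true) e) (count-full d)) ⟩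
    d                                                                      ∎
    where open ≡-Reasoning

  free-on : ∀ j → lookup free (κ j) ≡ true
  free-on j = trans (place-on (replicate n false) (replicate d true) j)
    (cong₂ _xor_ (lookup-replicate j true) (lookup-replicate (κ j) false))

  free-off : ∀ k → ¬ (∃ λ j → κ j ≡ k) → lookup free k ≡ false
  free-off k none = trans (place-off (replicate n false) (replicate d true) k none) (lookup-replicate k false)

  module _ (z : Vec Bool n) where

    place-face : IsFaceImage d n (place z)
    place-face = free , z , free-count , λ y → mk⇔ (λ { (x , refl) → forward x }) (backward y)
      where
      forward : ∀ x k → lookup free k ≡ false → lookup (place z x) k ≡ lookup z k
      forward x k off = place-off z x k λ { (j , refl) → true≢false (free-on j) off }
      backward : ∀ y → (∀ k → lookup free k ≡ false → lookup y k ≡ lookup z k) → ∃ λ x → place z x ≡ y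
      backward y agree = x , lookup-ext same
        where
        x = tabulate (λ j → lookup y (κ j) xor lookup z (κ j))
        same : ∀ k → lookup (place z x) k ≡ lookup y k
        same k with any? (λ j → κ j ≟ᶠ k)
        ... | yes (j , refl) = trans (place-on z x j)
                (trans (cong (_xor lookup z (κ j)) (lookup∘tabulate _ j)) (xor-undo (lookup y (κ j)) (lookup z (κ j))))
        ... | no none = trans (place-off z x k none) (sym (agree k (free-off k none)))

    place-cancel : ∀ {x y} j → lookup (place z x) (κ j) ≡ lookup (place z y) (κ j) → lookup x j ≡ lookup y j
    place-cancel {x} {y} j eq = xor-cancel _ _ (lookup z (κ j)) (trans (sym (place-on z x j)) (trans eq (place-on z y j)))

    place-cong : ∀ {x y} k → (∀ j → κ j ≡ k → lookup x j ≡ lookup y j) → lookup (place z x) k ≡ lookup (place z y) k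
    place-cong {x} {y} k eq with any? (λ j → κ j ≟ᶠ k)
    ... | yes (j , refl) = trans (place-on z x j) (trans (cong (_xor lookup z (κ j)) (eq j refl)) (sym (place-on z y j)))
    ... | no none        = trans (place-off z x k none) (sym (place-off z y k none))

    place-adjacent : ∀ x y → Adj d x y ⇔ Adj n (place z x) (place z y)
    place-adjacent x y = mk⇔ forward backward
      where
      forward : Adj d x y → Adj n (place z x) (place z y)
      forward (i , differ , agree) = κ i , differ ∘ place-cancel {x} {y} i ,
        λ k k≢ → place-cong {x} {y} k (λ j κj≡k → agree j (λ { refl → k≢ (sym κj≡k) }))
      backward : Adj n (place z x) (place z y) → Adj d x y
      backward (k , differ , agree) with any? (λ j → κ j ≟ᶠ k)
      ... | yes (i , refl) = i , (λ eq → differ (place-cong {x} {y} (κ i) (λ j κj≡ → subst (λ j → lookup x j ≡ lookup y j) (sym (κ-injective κj≡)) eq))) ,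
              λ j j≢i → place-cancel {x} {y} j (agree (κ j) (j≢i ∘ κ-injective))
      ... | no none = contradiction (place-cong {x} {y} k (λ j κj≡k → contradiction (j , κj≡k) none)) differ

    embedding : Embedding d n
    embedding = place z , place-face , (λ x y eq → lookup-ext (λ j → place-cancel {x} {y} j (cong (λ w → lookup w (κ j)) eq))) , place-adjacent

-- An edge of `S` is put in with both orientations, since `act` may traverse it from either end.
-- Clearing bit `i` finds the end under which `S` stores it.
symmetric : ∀ {n} → QEdgeSet n → DirectedEdges n
symmetric S z i = S (z [ i ]≔ false) i

symmetric-member : ∀ {n} (S : QEdgeSet n) w k → symmetric S w k ≡ true → MemE S w (flip k w)
symmetric-member S w k mem with lookup w k in eq
... | false = k , inj₁ (eq , updateAt-cong-local k w (cong not eq) , trans (cong (λ v → S v k) (sym w≡)) mem)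
  where
  w≡ : w [ k ]≔ false ≡ w
  w≡ = trans (cong (w [ k ]≔_) (sym eq)) ([]≔-lookup w k)
... | true = k , inj₂ (trans (lookup∘updateAt k w) (cong not eq) ,
    sym (trans (cong (_[ k ]≔ true) (sym w≡)) (trans ([]≔-idempotent w k) (trans (cong (w [ k ]≔_) (sym eq)) ([]≔-lookup w k)))) ,
    trans (cong (λ v → S v k) (sym w≡)) mem)
  where
  w≡ : w [ k ]≔ false ≡ flip k w
  w≡ = sym (updateAt-cong-local k w (cong not eq))

edges-symmetric : ∀ {n} (S : QEdgeSet n) → edges (symmetric S) ≡ 2 * size S
edges-symmetric {n} S = begin
  edges (symmetric S)                                                                     ≡⟨ ∑-swap (allVecs n) (allFin n) _ ⟩
  ∑ (allFin n) (λ i → ∑ (allVecs n) (λ z → indicator (S (z [ i ]≔ false) i)))             ≡⟨ ∑-cong (allFin n) (λ i → ∑-allVecs-clear i (λ z → indicator (S z i))) ⟩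
  ∑ (allFin n) (λ i → 2 * ∑ (allVecs n) (λ z → if not (lookup z i) then indicator (S z i) else 0))
                                                                                          ≡⟨ ∑-*ˡ (allFin n) 2 _ ⟩
  2 * ∑ (allFin n) (λ i → ∑ (allVecs n) (λ z → if not (lookup z i) then indicator (S z i) else 0))
                                                                                          ≡⟨ cong (2 *_) (sym (∑-swap (allVecs n) (allFin n) _)) ⟩
  2 * ∑ (allVecs n) (λ z → ∑ (allFin n) (λ i → if not (lookup z i) then indicator (S z i) else 0))
                                                                                          ≡⟨ cong (2 *_) (∑-cong (allVecs n) (λ z → ∑-cong (allFin n) (λ i → if-∧ (not (lookup z i)) (S z i)))) ⟩
  2 * size S                                                                              ∎
  where
  open ≡-Reasoning
  if-∧ : ∀ a b → (if a then indicator b else 0) ≡ (if a ∧ b then 1 else 0)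
  if-∧ true  b = refl
  if-∧ false b = refl

^-distribʳ-* : ∀ k m n → (m * n) ^ k ≡ m ^ k * n ^ k
^-distribʳ-* zero    m n = refl
^-distribʳ-* (suc k) m n rewrite ^-distribʳ-* k m n =
  solve 4 (λ a b c d → a :* b :* (c :* d) := a :* c :* (b :* d)) refl m n (m ^ k) (n ^ k)
  where open +-*-Solver

module Copies {v d : ℕ} (g : Ends v (suc d)) (e : Fin (suc d)) where

  all-but-e : Vec Bool (suc d)
  all-but-e = replicate (suc d) true [ e ]≔ false

  all-but-e-member : ∀ {h} → h ≢ e → lookup all-but-e h ≡ true
  all-but-e-member {h} h≢e = trans (lookup∘update′ h≢e (replicate (suc d) true) false) (lookup-replicate h true)

  lift-tree : ∀ (x : Vec Bool d) h → IsSpanningTree (graph g) (Lift (graph g) e x h) → Tree g (insertAt x e false ⊕ h)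
  lift-tree x h = tree-cong to from
    where
    to : ∀ f → Lift (graph g) e x h f → (insertAt x e false ⊕ h) f
    to f (inj₁ f≡h)             = inj₂ f≡h
    to f (inj₂ (j , refl , on)) = inj₁ (trans (insertAt-punchIn x e false j) on)
    from : ∀ f → (insertAt x e false ⊕ h) f → Lift (graph g) e x h f
    from f (inj₂ f≡h) = inj₁ f≡h
    from f (inj₁ on) with e ≟ᶠ f
    ... | yes refl = contradiction (insertAt-lookup x e false) (true≢false on)
    ... | no e≢f   = inj₂ (punchOut e≢f , punchIn-punchOut e≢f ,
            trans (sym (insertAt-punchIn x e false (punchOut e≢f))) (trans (cong (lookup (insertAt x e false)) (punchIn-punchOut e≢f)) on))

  inY-treePair : ∀ x i → lookup x i ≡ false → InY (graph g) e x i → TreePair g e all-but-e (insertAt x e false) (punchIn e i)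
  inY-treePair x i off (tree-e , tree-i) = treePair
    (λ h on → all-but-e-member (λ { refl → true≢false on (insertAt-lookup x e false) }))
    (all-but-e-member (punchInᵢ≢i e i)) (trans (insertAt-punchIn x e false i) off) (lift-tree x e tree-e) (lift-tree x (punchIn e i) tree-i)

  injective-copy : ∀ {n} (S : QEdgeSet n) z φ → Hits (symmetric S) (TreePair g e all-but-e) z φ → (inj : Injective φ) →
    CopyIn (graph g) e (Face.embedding e φ inj z) S
  injective-copy S z φ hits inj x i off y = subst (MemE S (place z x)) (sym (place-update z x i off))
    (symmetric-member S (place z x) (κ i) (hits (insertAt x e false) (punchIn e i) (inY-treePair x i off y)))
    where open Face e φ inj

  -- All the weight sits on maps with a coincidence, which bounds its total by the fraction m²/n of
  -- the mass, where m is the number of edges of the graph. The two orientations give a factor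
  -- `2 ^ C` on both sides, and `1 ≤ C` allows m² to be replaced by its power.
  free-bound : ∀ {n C} .{{_ : NonZero n}} (S : QEdgeSet n) → 1 ≤ C → YFree (graph g) e n S →
    Packing (TreePair g e all-but-e) all-but-e C (symmetric S) →
    size S ^ C * n ^ 1 ≤ (suc d * suc d) ^ C * eQ n ^ C
  free-bound {suc n₀} {C} S 1≤C free packing = *-cancelˡ-≤ (2 ^ C * M) {{m*n≢0 (2 ^ C) M {{m^n≢0 2 C}} {{mass≢0 n m}}}} (begin
    2 ^ C * M * (s ^ C * n ^ 1)               ≡⟨ solve 4 (λ a b c d → a :* b :* (c :* (d :* con 1)) := d :* (a :* c :* b)) refl (2 ^ C) M (s ^ C) n ⟩
    n * (2 ^ C * s ^ C * M)                   ≡⟨ cong (λ x → n * (x * M)) (trans (sym (^-distribʳ-* C 2 s)) (cong (_^ C) (sym (edges-symmetric S)))) ⟩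
    n * (edges (symmetric S) ^ C * M)         ≤⟨ *-monoʳ-≤ n bound ⟩
    n * ((2 ^ n * n) ^ C * total weight)      ≡⟨ solve 3 (λ a b c → a :* (b :* c) := b :* (a :* c)) refl n ((2 ^ n * n) ^ C) (total weight) ⟩
    -- An injective `φ` of nonzero weight would yield an embedding that `free` forbids.
    (2 ^ n * n) ^ C * (n * total weight)      ≤⟨ *-monoʳ-≤ ((2 ^ n * n) ^ C) (total-clashes weight ≤1 λ z φ w≢0 inj → free (Face.embedding e φ inj z) (injective-copy S z φ (hits z φ w≢0) inj)) ⟩
    (2 ^ n * n) ^ C * (m * m * M)             ≡⟨ cong (λ x → x ^ C * (m * m * M)) double ⟩
    (2 * eQ n) ^ C * (m * m * M)              ≡⟨ cong (_* (m * m * M)) (^-distribʳ-* C 2 (eQ n)) ⟩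
    2 ^ C * eQ n ^ C * (m * m * M)            ≤⟨ *-monoʳ-≤ (2 ^ C * eQ n ^ C) (*-monoˡ-≤ M (m≤m^C)) ⟩
    2 ^ C * eQ n ^ C * ((m * m) ^ C * M)      ≡⟨ solve 4 (λ a b c d → a :* b :* (c :* d) := a :* d :* (c :* b)) refl (2 ^ C) (eQ n ^ C) ((m * m) ^ C) M ⟩
    2 ^ C * M * ((m * m) ^ C * eQ n ^ C)      ∎)
    where
    open ≤-Reasoning
    open +-*-Solver
    open Packing packing
    n = suc n₀
    m = suc d
    M = mass n m
    s = size S
    double : 2 ^ n * n ≡ 2 * eQ n
    double = solve 2 (λ a n → con 2 :* a :* n := con 2 :* (n :* a)) refl (2 ^ n₀) n
    m≤m^C : m * m ≤ (m * m) ^ C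
    m≤m^C = subst (_≤ (m * m) ^ C) (^-identityʳ (m * m)) (^-monoʳ-≤ (m * m) 1≤C)

theorem1p2 : (G : MGraph) (e : Fin (E G)) →
    Connected G → SeriesParallel G → ¬ IsLoop G e → ¬ IsBridge G e →
    Σ ℕ λ p → Σ ℕ λ q → Σ ℕ λ C → Σ ℕ λ N →
    (1 ≤ p) × (1 ≤ q) ×
    (∀ n → N ≤ n → ∀ (S : QEdgeSet n) → YFree G e n S →
    size S ^ q * n ^ p ≤ C ^ q * eQ n ^ q)
theorem1p2 record { V = v ; E = suc d ; ends = g } e conn noK4 noLoop _
  with abundant-trees v g e conn noK4 noLoop (replicate (suc d) true [ e ]≔ false) (lookup∘update e (replicate (suc d) true) false)
-- The exponent is ε = 1/C, the constant comes from the union bound over pairs of edges, and the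
-- threshold 1 makes `n` nonzero.
... | C , 1≤C , packing = 1 , C , suc d * suc d , 1 , s≤s z≤n , 1≤C ,
  λ { (suc n) _ S free → Copies.free-bound g e S 1≤C free (packing (suc n) (symmetric S)) }
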